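{- If $G$ is a connected graph of order $n$, then $\iota_{\rm g}'(G)\le \frac{1}{2}n$, with equality if and only if $G$ is isomorphic to one of the eleven graphs $F_1,\dots,F_{11}$ described below. $F_1=K_2$; $F_2=P_4$ (path on four vertices); $F_3$ is the paw (a triangle $abc$ together with a vertex $d$ adjacent only to $a$); $F_4$ is the tree obtained from the path $d_1d_2\cdots d_7$ by adding a vertex adjacent only to $d_4$; $F_5$ is obtained from a triangle $e_1e_2e_3$ and a path $e_3e_4e_5e_6e_7$ (sharing $e_3$) by adding a vertex adjacent only to $e_4$; $F_6$ is obtained from two disjoint triangles $g_1g_2g_3$ and $g_5g_6g_7$, a vertex $g_4$ adjacent to $g_3$ and $g_5$, and a further vertex adjacent only to $g_4$. For $F_7,\dots,F_{11}$, start with a $6$-cycle $c_1c_2c_3c_4c_5c_6c_1$ and two further vertices $u,v$ with the edge $uv$ ($u$ has no other neighbors), and join $v$ to cycle vertices as follows: in $F_7$, $v$ is adjacent to $c_1$ only; in $F_8$, to $c_1$ and $c_2$; in $F_9$, to $c_1$ and $c_3$; in $F_{10}$, to $c_1$ and $c_4$; in $F_{11}$, to $c_6$, $c_1$ and $c_2$.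
   Context: For a graph $G$ and $X\subseteq V(G)$, $N_G[X]$ denotes the set of vertices in $X$ or adjacent to a vertex of $X$. The isolation game on a finite graph $G$ is played by two players, Dominator and Staller, who alternately select vertices of $G$. If $X$ is the set of vertices selected so far, a vertex $x$ may be selected (is playable) only if $x$ dominates (i.e., equals or is adjacent to) some vertex belonging to a component of $G - N_G[X]$ with at least two vertices. The game ends when no playable vertex exists. Dominator aims to minimize the total number of selected vertices, Staller aims to maximize it. $\iota_{\rm g}'(G)$ denotes the number of vertices selected when Staller makes the first move and both play optimally. -}

module Defs where

open import Data.Nat using (ℕ; zero; suc; _+_; _*_; _≤_; _⊔_; _⊓_; _≤ᵇ_)
open import Data.Bool using (Bool; true; false; _∧_; _∨_; not; if_then_else_)
open import Data.Bool.Properties using (∨-comm; ∧-zeroʳ)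
open import Data.Fin using (Fin; zero; suc; _≟_; #_)
open import Data.List using (List; []; _∷_; map; foldr; filter)
open import Data.Product using (Σ; _×_; _,_)
open import Data.Sum using (_⊎_)
open import Function.Bundles using (_↔_; Inverse)
open import Relation.Nullary using (yes; no; does)
open import Relation.Nullary.Decidable using (⌊_⌋)
open import Relation.Binary.PropositionalEquality using (_≡_; refl; sym; cong)

record Graph (n : ℕ) : Set where
  field
    adj : Fin n → Fin n → Bool
    adj-sym : ∀ i j → adj i j ≡ adj j i
    adj-irr : ∀ i → adj i i ≡ false
open Graph public

data Walk {n : ℕ} (G : Graph n) : Fin n → Fin n → Set where
  here : ∀ {i} → Walk G i i
  step : ∀ {i j k} → adj G i j ≡ true → Walk G j k → Walk G i k

Connected : ∀ {n} → Graph n → Set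
Connected {n} G = (i j : Fin n) → Walk G i j

Isomorphic : ∀ {n m} → Graph n → Graph m → Set
Isomorphic {n} {m} G H =
  Σ (Fin n ↔ Fin m) λ f →
    (i j : Fin n) → adj H (Inverse.to f i) (Inverse.to f j) ≡ adj G i j

anyF : ∀ {n} → (Fin n → Bool) → Bool
anyF {zero} p = false
anyF {suc n} p = p zero ∨ anyF (λ i → p (suc i))

countF : ∀ {n} → (Fin n → Bool) → ℕ
countF {zero} p = 0
countF {suc n} p = (if p zero then 1 else 0) + countF (λ i → p (suc i))

allFinL : ∀ n → List (Fin n)
allFinL zero = []
allFinL (suc n) = zero ∷ map suc (allFinL n)

eqF : ∀ {n} → Fin n → Fin n → Bool
eqF i j = ⌊ i ≟ j ⌋

Subset : ℕ → Set
Subset n = Fin n → Bool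

module _ {n : ℕ} (G : Graph n) where

  closedN : Subset n → Subset n
  closedN X y = X y ∨ anyF (λ x → X x ∧ adj G x y)

  remaining : Subset n → Subset n
  remaining X y = not (closedN X y)

  closeStep : Subset n → Subset n → Subset n
  closeStep R S y = S y ∨ (R y ∧ anyF (λ z → S z ∧ adj G z y))

  iterate : ℕ → (Subset n → Subset n) → Subset n → Subset n
  iterate zero f S = S
  iterate (suc k) f S = iterate k f (f S)

  -- the vertex set of the component of G - N_G[X] containing y
  -- (empty if y is not a vertex of G - N_G[X])
  component : Subset n → Fin n → Subset n
  component X y =
    iterate n (closeStep (remaining X)) (λ z → eqF z y ∧ remaining X y)

  inBigComponent : Subset n → Fin n → Bool
  inBigComponent X y = remaining X y ∧ (2 ≤ᵇ countF (component X y))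

  playable : Subset n → Fin n → Bool
  playable X x = anyF (λ y → inBigComponent X y ∧ (eqF x y ∨ adj G x y))

  insert : Subset n → Fin n → Subset n
  insert X x y = eqF y x ∨ X y

  data Player : Set where
    dominator staller : Player

  other : Player → Player
  other dominator = staller
  other staller = dominator

  maxL : List ℕ → ℕ
  maxL = foldr _⊔_ 0

  minL : List ℕ → ℕ
  minL [] = 0
  minL (a ∷ as) = foldr _⊓_ a as

  optimum : Player → List ℕ → ℕ
  optimum dominator = minL
  optimum staller = maxL

  -- number of vertices still to be selected under optimal play, when
  -- X has been selected and player p is to move.  The fuel bounds the
  -- length of the game (every selected vertex is new, so fuel n suffices).
  gameValue : ℕ → Player → Subset n → ℕ
  gameValue zero p X = 0
  gameValue (suc f) p X =
    if anyF (playable X)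
    then suc (optimum p (map (λ x → gameValue f (other p) (insert X x))
                             (filter (λ x → playable X x ≟B true) (allFinL n))))
    else 0
    where
      open import Data.Bool using () renaming (_≟_ to _≟B_)

  isolationGameS : ℕ
  isolationGameS = gameValue n staller (λ _ → false)

private
  eqF-sym : ∀ {n} (i j : Fin n) → eqF i j ≡ eqF j i
  eqF-sym i j with i ≟ j | j ≟ i
  ... | yes _ | yes _ = refl
  ... | no _ | no _ = refl
  ... | yes p | no q = Data.Empty.⊥-elim (q (sym p))
    where import Data.Empty
  ... | no p | yes q = Data.Empty.⊥-elim (p (sym q))
    where import Data.Empty

  eqF-refl : ∀ {n} (i : Fin n) → eqF i i ≡ true
  eqF-refl i with i ≟ i
  ... | yes _ = refl
  ... | no p = Data.Empty.⊥-elim (p refl)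
    where import Data.Empty

hasEdge : ∀ {n} → List (Fin n × Fin n) → Fin n → Fin n → Bool
hasEdge [] i j = false
hasEdge ((a , b) ∷ es) i j = (eqF a i ∧ eqF b j) ∨ hasEdge es i j

fromEdges : ∀ n → List (Fin n × Fin n) → Graph n
fromEdges n es = record
  { adj = λ i j → not (eqF i j) ∧ (hasEdge es i j ∨ hasEdge es j i)
  ; adj-sym = λ i j → prf i j
  ; adj-irr = λ i → irr i
  }
  where
    prf : ∀ i j → (not (eqF i j) ∧ (hasEdge es i j ∨ hasEdge es j i))
                ≡ (not (eqF j i) ∧ (hasEdge es j i ∨ hasEdge es i j))
    prf i j rewrite eqF-sym i j | ∨-comm (hasEdge es i j) (hasEdge es j i) = refl
    irr : ∀ i → (not (eqF i i) ∧ (hasEdge es i i ∨ hasEdge es i i)) ≡ false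
    irr i rewrite eqF-refl i = refl

F1 : Graph 2
F1 = fromEdges 2 ((# 0 , # 1) ∷ [])

F2 : Graph 4
F2 = fromEdges 4 ((# 0 , # 1) ∷ (# 1 , # 2) ∷ (# 2 , # 3) ∷ [])

-- F3 = paw: a=0, b=1, c=2, d=3
F3 : Graph 4
F3 = fromEdges 4 ((# 0 , # 1) ∷ (# 1 , # 2) ∷ (# 0 , # 2) ∷ (# 0 , # 3) ∷ [])

-- F4: path d1..d7 = 0..6, extra vertex 7 adjacent to d4 = 3
F4 : Graph 8
F4 = fromEdges 8 ((# 0 , # 1) ∷ (# 1 , # 2) ∷ (# 2 , # 3) ∷ (# 3 , # 4) ∷
                  (# 4 , # 5) ∷ (# 5 , # 6) ∷ (# 7 , # 3) ∷ [])

-- F5: triangle e1e2e3, path e3..e7 (e_i = i-1), extra vertex 7 adjacent to e4 = 3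
F5 : Graph 8
F5 = fromEdges 8 ((# 0 , # 1) ∷ (# 1 , # 2) ∷ (# 0 , # 2) ∷
                  (# 2 , # 3) ∷ (# 3 , # 4) ∷ (# 4 , # 5) ∷ (# 5 , # 6) ∷
                  (# 7 , # 3) ∷ [])

-- F6: triangles g1g2g3, g5g6g7 (g_i = i-1), g4 = 3 adjacent to g3, g5,
-- extra vertex 7 adjacent to g4
F6 : Graph 8
F6 = fromEdges 8 ((# 0 , # 1) ∷ (# 1 , # 2) ∷ (# 0 , # 2) ∷
                  (# 4 , # 5) ∷ (# 5 , # 6) ∷ (# 4 , # 6) ∷
                  (# 3 , # 2) ∷ (# 3 , # 4) ∷ (# 7 , # 3) ∷ [])

-- F7..F11: 6-cycle c1..c6 = 0..5, u = 6, v = 7, edge uv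
cycleUV : List (Fin 8 × Fin 8)
cycleUV = (# 0 , # 1) ∷ (# 1 , # 2) ∷ (# 2 , # 3) ∷ (# 3 , # 4) ∷
          (# 4 , # 5) ∷ (# 5 , # 0) ∷ (# 6 , # 7) ∷ []

F7 : Graph 8
F7 = fromEdges 8 ((# 7 , # 0) ∷ cycleUV)

F8 : Graph 8
F8 = fromEdges 8 ((# 7 , # 0) ∷ (# 7 , # 1) ∷ cycleUV)

F9 : Graph 8
F9 = fromEdges 8 ((# 7 , # 0) ∷ (# 7 , # 2) ∷ cycleUV)

F10 : Graph 8
F10 = fromEdges 8 ((# 7 , # 0) ∷ (# 7 , # 3) ∷ cycleUV)

F11 : Graph 8
F11 = fromEdges 8 ((# 7 , # 5) ∷ (# 7 , # 0) ∷ (# 7 , # 1) ∷ cycleUV)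

IsOneOfF : ∀ {n} → Graph n → Set
IsOneOfF G =
  Isomorphic G F1 ⊎ Isomorphic G F2 ⊎ Isomorphic G F3 ⊎ Isomorphic G F4 ⊎
  Isomorphic G F5 ⊎ Isomorphic G F6 ⊎ Isomorphic G F7 ⊎ Isomorphic G F8 ⊎
  Isomorphic G F9 ⊎ Isomorphic G F10 ⊎ Isomorphic G F11

{-# OPTIONS --safe #-}
module Submission where

-- Call an undominated vertex live if it has an undominated neighbor; only live vertices matter for the rest
-- of the game. Staller's first move removes at least two of them. While some live vertex has two live
-- neighbors, Dominator plays it and removes three, so each further pair of moves removes at least four; once
-- the live vertices induce a matching, every single move removes at least two. This gives the bound n/2.
--
-- If equality holds, Staller starts at a leaf x with neighbor y, every other vertex stays live, Dominator can
-- never remove four vertices at once, and to each move of Dominator removing three vertices Staller must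
-- reply by removing exactly one; the reply is y or one of the three vertices just removed. The live graph then
-- has maximum degree two and no pendant path on four vertices. If none of its components is a cycle of length
-- at least five, every reply is y, there are exactly two components, triangles or paths on three vertices, each
-- attached to y by one edge: F₄, F₅, F₆. On a longer cycle the replies force length at most seven; a further
-- component would leave Staller without such a reply, and parity then leaves a hexagon: F₇, …, F₁₁.

open import Defs
open import Data.Bool using (true; false; Bool; _∧_; _∨_; not; if_then_else_)
import Data.Bool as Bool
open import Data.Bool.Properties using (∧-conicalˡ; ∧-conicalʳ; ∨-zeroʳ; ¬-not)
open import Data.Empty using (⊥; ⊥-elim)
open import Data.Fin using (Fin; zero; suc; _≟_; #_)
open import Data.Fin.Permutation using (↔⇒≡)
open import Data.Fin.Properties using (any?; all?)
open import Data.List using (List; []; _∷_; length; map; foldr; filter; applyUpTo)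
open import Data.List.Membership.Propositional using (_∈_)
open import Data.List.Membership.Propositional.Properties using (∈-map⁺; ∈-map⁻; ∈-filter⁺; ∈-filter⁻; ∈-applyUpTo⁺; ∈-applyUpTo⁻)
open import Data.List.Relation.Unary.All as All using (All; []; _∷_)
open import Data.List.Relation.Unary.AllPairs using ([]; _∷_)
open import Data.List.Relation.Unary.Any using (here; there)
open import Data.List.Relation.Unary.Unique.Propositional using (Unique)
open import Data.Nat using (ℕ; zero; suc; _+_; _*_; _≤_; _⊓_; z≤n; s≤s; s≤s⁻¹; _/_; _%_)
open import Data.Nat.DivMod using (m≡m%n+[m/n]*n; m%n<n)
open import Data.Nat.Properties
  using (≤-refl; ≤-trans; ≤-reflexive; ≤-antisym; n≤1+n; +-comm; +-assoc; +-suc; +-monoʳ-≤;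
         +-mono-≤; +-cancelˡ-≤; *-suc; *-distribˡ-+; *-monoʳ-≤; ⊔-sel; ⊔-identityʳ; ⊓-glb;
         m⊓n≤m; m⊓n≤n; m≤m⊔n; m≤n⊔m; m≤m+n; 1+n≰n; even≢odd; ≤ᵇ⇒≤; ≤⇒≤ᵇ; module ≤-Reasoning)
open import Data.Product using (Σ; _×_; _,_; proj₁; proj₂; ∃)
open import Data.Sum using (_⊎_; inj₁; inj₂; [_,_]′)
open import Data.Unit using (⊤; tt)
open import Data.Vec using (Vec; []; _∷_; lookup; tabulate; replicate)
open import Data.Vec.Properties using (lookup∘tabulate; lookup-replicate)
open import Function using (_∘_; case_of_)
open import Function.Bundles using (Inverse; mk↔ₛ′; _⇔_; mk⇔)
open import Relation.Nullary using (¬_; Dec; yes; no; ¬?)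
open import Relation.Nullary.Decidable using (True; toWitness; map′; _×-dec_; _⊎-dec_)
open import Relation.Binary.PropositionalEquality using (_≡_; _≢_; refl; sym; trans; cong; cong₂; subst; ≢-sym)

-- `Force m p L` says that Staller can make the game last `m` more moves, so a single Dominator move
-- after which the count fails refutes it; the strategies of Dominator never have to be described in
-- full. In a tight position, with Dominator to move, the live vertices number exactly `2 * m`.
-- After any move of Dominator and the reply in Staller's strategy at least `2 * (m - 2)` of them
-- must be left, so the two moves together remove at most four. If Dominator's move removes three,
-- the reply removes one and the remainder is tight again. This heredity is the main tool: a
-- configuration forbidden in tight positions is also forbidden after the four vertices are deleted,
-- and deleting them tends to cut a cycle into a forbidden pendant path. The limit on the reply also
-- explains where it comes from: a vertex still live would remove itself and a live neighbor, and
-- the leaf `x` dominates no live vertex. A reply by a vertex of a long cycle deletes four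
-- consecutive vertices; the bound seven arises because a longer cycle would leave a pendant path on
-- at least four vertices.

∧-intro : ∀ {a b} → a ≡ true → b ≡ true → a ∧ b ≡ true
∧-intro refl refl = refl

∨-split : ∀ a {b} → a ∨ b ≡ true → a ≡ true ⊎ b ≡ true
∨-split true  _ = inj₁ refl
∨-split false p = inj₂ p

∨-introˡ : ∀ {a b} → a ≡ true → a ∨ b ≡ true
∨-introˡ refl = refl

∨-introʳ : ∀ a {b} → b ≡ true → a ∨ b ≡ true
∨-introʳ a refl = ∨-zeroʳ a

not-true : ∀ {a} → not a ≡ true → ¬ a ≡ true
not-true p refl = case p of λ ()

not-intro : ∀ {a} → ¬ a ≡ true → not a ≡ true
not-intro {true}  q = ⊥-elim (q refl)
not-intro {false} _ = refl

truth-ext : ∀ {a b} → (a ≡ true → b ≡ true) → (b ≡ true → a ≡ true) → a ≡ b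
truth-ext {true}          f _ = sym (f refl)
truth-ext {false} {true}  _ g = g refl
truth-ext {false} {false} _ _ = refl

-- Finite search, membership and distinctness

anyF-witness : ∀ {n} (p : Fin n → Bool) → anyF p ≡ true → Σ (Fin n) λ i → p i ≡ true
anyF-witness {suc n} p q with ∨-split (p zero) q
... | inj₁ h = zero , h
... | inj₂ h with i , e ← anyF-witness (p ∘ suc) h = suc i , e

anyF-intro : ∀ {n} (p : Fin n → Bool) i → p i ≡ true → anyF p ≡ true
anyF-intro p zero    q = ∨-introˡ q
anyF-intro p (suc i) q = ∨-introʳ (p zero) (anyF-intro (p ∘ suc) i q)

eqF-sound : ∀ {n} {i j : Fin n} → eqF i j ≡ true → i ≡ j
eqF-sound {i = i} {j} p with i ≟ j
... | yes e = e

eqF-complete : ∀ {n} {i j : Fin n} → i ≡ j → eqF i j ≡ true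
eqF-complete {i = i} {j} e with i ≟ j
... | yes _ = refl
... | no ne = ⊥-elim (ne e)

infix 4 _∈ˢ_ _∉ˢ_ _∉_

_∈ˢ_ _∉ˢ_ : ∀ {n} → Fin n → Subset n → Set
z ∈ˢ L = L z ≡ true
z ∉ˢ L = ¬ z ∈ˢ L

_∉_ : ∀ {n} → Fin n → List (Fin n) → Set
z ∉ zs = All (z ≢_) zs

locate : ∀ {n} (z : Fin n) zs → z ∈ zs ⊎ z ∉ zs
locate z [] = inj₂ []
locate z (a ∷ zs) with z ≟ a
... | yes e = inj₁ (here e)
... | no ne with locate z zs
...   | inj₁ m = inj₁ (there m)
...   | inj₂ m = inj₂ (ne ∷ m)

uniq3 : ∀ {n} {a b c : Fin n} → a ≢ b → a ≢ c → b ≢ c → Unique (a ∷ b ∷ c ∷ [])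
uniq3 ab ac bc = (ab ∷ ac ∷ []) ∷ (bc ∷ []) ∷ [] ∷ []

uniq4 : ∀ {n} {a b c d : Fin n} → a ≢ b → a ≢ c → a ≢ d → b ≢ c → b ≢ d → c ≢ d →
  Unique (a ∷ b ∷ c ∷ d ∷ [])
uniq4 ab ac ad bc bd cd = (ab ∷ ac ∷ ad ∷ []) ∷ uniq3 bc bd cd

-- Cardinalities

bit-mono : ∀ a b → (a ≡ true → b ≡ true) → (if a then 1 else 0) ≤ (if b then 1 else 0)
bit-mono false b     h = z≤n
bit-mono true  true  h = ≤-refl
bit-mono true  false h = case h refl of λ ()

countF-mono : ∀ {n} (P Q : Subset n) → (∀ z → z ∈ˢ P → z ∈ˢ Q) → countF P ≤ countF Q
countF-mono {zero}  P Q h = z≤n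
countF-mono {suc n} P Q h = +-mono-≤ (bit-mono (P zero) (Q zero) (h zero)) (countF-mono (P ∘ suc) (Q ∘ suc) (h ∘ suc))

countF-strict : ∀ {n} (P Q : Subset n) → (∀ z → z ∈ˢ P → z ∈ˢ Q) →
  ∀ z → z ∉ˢ P → z ∈ˢ Q → suc (countF P) ≤ countF Q
countF-strict {suc n} P Q h zero z∉ z∈ with P zero | Q zero
... | true  | _    = ⊥-elim (z∉ refl)
... | false | true = s≤s (countF-mono (P ∘ suc) (Q ∘ suc) (h ∘ suc))
countF-strict {suc n} P Q h (suc z) z∉ z∈ =
  ≤-trans (≤-reflexive (sym (+-suc (if P zero then 1 else 0) _)))
    (+-mono-≤ (bit-mono (P zero) (Q zero) (h zero)) (countF-strict (P ∘ suc) (Q ∘ suc) (h ∘ suc) z z∉ z∈))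

_without_ : ∀ {n} → Subset n → Fin n → Subset n
(Q without z) y = Q y ∧ not (eqF y z)

without-intro : ∀ {n} {Q : Subset n} {z y} → y ∈ˢ Q → y ≢ z → y ∈ˢ Q without z
without-intro p ne = ∧-intro p (not-intro (ne ∘ eqF-sound))

without⇒∈ : ∀ {n} {Q : Subset n} {z y} → y ∈ˢ Q without z → y ∈ˢ Q
without⇒∈ {Q = Q} {y = y} = ∧-conicalˡ (Q y) _

without⇒≢ : ∀ {n} (Q : Subset n) {z y} → y ∈ˢ Q without z → y ≢ z
without⇒≢ Q {z} {y} p = not-true (∧-conicalʳ (Q y) _ p) ∘ eqF-complete

-- All counts of removed vertices take this form. The induction deletes the listed vertices from `Q`
-- one at a time, and distinctness keeps the later ones available.
countF-gap : ∀ {n} (P Q : Subset n) zs → (∀ z → z ∈ˢ P → z ∈ˢ Q) → Unique zs →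
  All (λ z → z ∈ˢ Q × z ∉ˢ P) zs → length zs + countF P ≤ countF Q
countF-gap P Q []       h _        _              = countF-mono P Q h
countF-gap P Q (z ∷ zs) h (z∉ ∷ u) ((q , p) ∷ as) =
  ≤-trans (s≤s (countF-gap P (Q without z) zs
                  (λ y y∈ → without-intro {Q = Q} (h y y∈) (λ { refl → p y∈ })) u (narrow z∉ as)))
          (countF-strict (Q without z) Q (λ y → without⇒∈ {Q = Q}) z (λ e → without⇒≢ Q e refl) q)
  where
  narrow : ∀ {ys} → All (z ≢_) ys → All (λ y → y ∈ˢ Q × y ∉ˢ P) ys →
    All (λ y → y ∈ˢ Q without z × y ∉ˢ P) ys
  narrow []       []              = []
  narrow (n ∷ ns) ((q , p) ∷ qps) = (without-intro {Q = Q} q (≢-sym n) , p) ∷ narrow ns qps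

countF-lower : ∀ {n} (Q : Subset n) zs → Unique zs → All (_∈ˢ Q) zs → length zs ≤ countF Q
countF-lower Q zs u as = ≤-trans (m≤m+n (length zs) (countF ∅)) (countF-gap ∅ Q zs (λ _ ()) u (All.map (λ q → q , λ ()) as))
  where
  ∅ : Subset _
  ∅ _ = false

countF-step : ∀ {n} (P : Subset n) z → countF P ≤ suc (countF (P without z))
countF-step {suc n} P zero with P zero
... | true  = s≤s (countF-mono (P ∘ suc) _ λ y p → without-intro {Q = P} {zero} {suc y} p (λ ()))
... | false = ≤-trans (countF-mono (P ∘ suc) _ λ y p → without-intro {Q = P} {zero} {suc y} p (λ ())) (n≤1+n _)
countF-step {suc n} P (suc z) =
  ≤-trans (+-mono-≤ (bit-mono (P zero) _ λ p → without-intro {Q = P} {suc z} {zero} p (λ ()))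
            (≤-trans (countF-step (P ∘ suc) z)
              (s≤s (countF-mono _ _ λ y p →
                 without-intro {Q = P} {suc z} {suc y} (without⇒∈ {Q = P ∘ suc} {z} {y} p) λ { refl → without⇒≢ (P ∘ suc) {z} {z} p refl }))))
    (≤-reflexive (+-suc _ _))

countF-upper : ∀ {n} (P : Subset n) zs → (∀ z → z ∈ˢ P → z ∈ zs) → countF P ≤ length zs
countF-upper P [] h = empty P (λ z p → case h z p of λ ())
  where
  empty : ∀ {n} (P : Subset n) → (∀ z → z ∉ˢ P) → countF P ≤ 0
  empty {zero}  P h = z≤n
  empty {suc n} P h with P zero in e
  ... | true  = ⊥-elim (h zero e)
  ... | false = empty (P ∘ suc) (h ∘ suc)
countF-upper P (z ∷ zs) h = ≤-trans (countF-step P z) (s≤s (countF-upper (P without z) zs inside))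
  where
  inside : ∀ y → y ∈ˢ P without z → y ∈ zs
  inside y p with h y (without⇒∈ {Q = P} p)
  ... | here e  = ⊥-elim (without⇒≢ P p e)
  ... | there m = m

countF≤n : ∀ {n} (P : Subset n) → countF P ≤ n
countF≤n {zero}  P = z≤n
countF≤n {suc n} P with P zero
... | true  = s≤s (countF≤n (P ∘ suc))
... | false = ≤-trans (countF≤n (P ∘ suc)) (n≤1+n n)

-- The game as a forcing relation

module Play {n : ℕ} (G : Graph n) where

  infix 4 _~_

  _~_ : Fin n → Fin n → Set
  a ~ b = adj G a b ≡ true

  ~-sym : ∀ {a b} → a ~ b → b ~ a
  ~-sym {a} {b} p = trans (adj-sym G b a) p

  ~-irr : ∀ {a} → ¬ a ~ a
  ~-irr {a} p = case trans (sym p) (adj-irr G a) of λ ()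

  ~⇒≢ : ∀ {a b} → a ~ b → a ≢ b
  ~⇒≢ p refl = ~-irr p

  Dom : Fin n → Fin n → Set
  Dom v z = v ≡ z ⊎ v ~ z

  domB : Fin n → Fin n → Bool
  domB v z = eqF v z ∨ adj G v z

  domB-sound : ∀ {v z} → domB v z ≡ true → Dom v z
  domB-sound {v} {z} p = [ inj₁ ∘ eqF-sound , inj₂ ]′ (∨-split (eqF v z) p)

  domB-complete : ∀ {v z} → Dom v z → domB v z ≡ true
  domB-complete         (inj₁ e) = ∨-introˡ (eqF-complete e)
  domB-complete {v} {z} (inj₂ e) = ∨-introʳ (eqF v z) e

  afterB : Subset n → Fin n → Subset n
  afterB L v z = L z ∧ (not (domB v z) ∧ anyF (λ w → adj G z w ∧ (L w ∧ not (domB v w))))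

  abstract
    -- Opaque, so that the general argument uses it only through `Survives`; evaluation on concrete
    -- graphs uses the transparent `afterB`. A vertex is lost not only when dominated but also when
    -- no undominated live neighbor remains.
    after : Subset n → Fin n → Subset n
    after = afterB

    after≡afterB : ∀ L v z → after L v z ≡ afterB L v z
    after≡afterB L v z = refl

  record Survives (L : Subset n) (v z : Fin n) : Set where
    constructor survives
    field
      live   : z ∈ˢ L
      safe   : ¬ Dom v z
      mate   : Fin n
      z~mate : z ~ mate
      mate∈  : mate ∈ˢ L
      mate-safe : ¬ Dom v mate

  abstract
    after⇒ : ∀ {L v z} → z ∈ˢ after L v → Survives L v z
    after⇒ {L} {v} {z} p =
      let q = ∧-conicalʳ (L z) _ p
          w , r = anyF-witness (λ w → adj G z w ∧ (L w ∧ not (domB v w))) (∧-conicalʳ (not (domB v z)) _ q)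
          t = ∧-conicalʳ (adj G z w) _ r
      in survives (∧-conicalˡ (L z) _ p) (not-true (∧-conicalˡ _ _ q) ∘ domB-complete)
           w (∧-conicalˡ _ _ r) (∧-conicalˡ _ _ t) (not-true (∧-conicalʳ (L w) _ t) ∘ domB-complete)

    ⇒after : ∀ {L v z} → Survives L v z → z ∈ˢ after L v
    ⇒after {L} {v} (survives l s w zw lw sw) =
      ∧-intro l (∧-intro (not-intro (s ∘ domB-sound))
        (anyF-intro (λ w → adj G _ w ∧ (L w ∧ not (domB v w))) w (∧-intro zw (∧-intro lw (not-intro (sw ∘ domB-sound))))))

  after⊆ : ∀ {L v z} → z ∈ˢ after L v → z ∈ˢ L
  after⊆ = Survives.live ∘ after⇒

  Playable : Subset n → Fin n → Set
  Playable L v = Σ (Fin n) λ z → z ∈ˢ L × Dom v z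

  -- The clause for Dominator also asks for some playable vertex, since the universal part alone
  -- would hold vacuously once the game is over.
  Force : ℕ → Player G → Subset n → Set
  Force zero    _         L = ⊤
  Force (suc m) staller   L = Σ (Fin n) λ v → Playable L v × Force m dominator (after L v)
  Force (suc m) dominator L = Σ (Fin n) (Playable L) × (∀ v → Playable L v → Force m staller (after L v))

  Closed : Subset n → Set
  Closed L = ∀ {z} → z ∈ˢ L → Σ (Fin n) λ w → w ∈ˢ L × z ~ w

  after-closed : ∀ {L v} → Closed (after L v)
  after-closed p with survives l s w zw lw sw ← after⇒ p =
    w , ⇒after (survives lw sw _ (~-sym zw) l s) , zw

  -- Correspondence with the fuelled game value

  remaining⇒ : ∀ {X y} → remaining G X y ≡ true → ∀ {x} → X x ≡ true → ¬ Dom x y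
  remaining⇒ {X} {y} p q (inj₁ refl) = not-true p (∨-introˡ q)
  remaining⇒ {X} {y} p q (inj₂ e)    = not-true p (∨-introʳ (X y) (anyF-intro (λ x → X x ∧ adj G x y) _ (∧-intro q e)))

  ⇒remaining : ∀ {X y} → (∀ {x} → X x ≡ true → ¬ Dom x y) → remaining G X y ≡ true
  ⇒remaining {X} {y} h = not-intro λ p → [ (λ q → h q (inj₁ refl)) , viaAny ]′ (∨-split (X y) p)
    where
    viaAny : anyF (λ x → X x ∧ adj G x y) ≡ true → ⊥
    viaAny q with x , r ← anyF-witness (λ x → X x ∧ adj G x y) q = h (∧-conicalˡ (X x) _ r) (inj₂ (∧-conicalʳ (X x) _ r))

  Live : Subset n → Fin n → Set
  Live X y = remaining G X y ≡ true × Σ (Fin n) λ z → remaining G X z ≡ true × y ~ z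

  -- Without an undominated neighbor of `y` the closure that computes its component never grows
  -- beyond `y`.
  big⇒ : ∀ {X y} → inBigComponent G X y ≡ true → Live X y
  big⇒ {X} {y} p with anyF (λ z → remaining G X z ∧ adj G y z) in e
  ... | true with z , q ← anyF-witness _ e =
    ∧-conicalˡ (remaining G X y) _ p , z , ∧-conicalˡ (remaining G X z) _ q , ∧-conicalʳ (remaining G X z) _ q
  ... | false = ⊥-elim (1+n≰n (≤-trans (≤ᵇ⇒≤ 2 _ (subst Bool.T (sym (∧-conicalʳ (remaining G X y) _ p)) _))
                 (countF-upper _ (y ∷ []) (λ z q → here (stays n _ start z q)))))
    where
    start : ∀ z → eqF z y ∧ remaining G X y ≡ true → z ≡ y
    start z q = eqF-sound (∧-conicalˡ _ _ q)
    grow : ∀ S → (∀ z → S z ≡ true → z ≡ y) → ∀ z → closeStep G (remaining G X) S z ≡ true → z ≡ y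
    grow S h z q with ∨-split (S z) q
    ... | inj₁ r = h z r
    ... | inj₂ r with x , t ← anyF-witness (λ w → S w ∧ adj G w z) (∧-conicalʳ (remaining G X z) _ r)
                 with refl ← h x (∧-conicalˡ (S x) _ t) =
      case trans (sym e) (anyF-intro (λ z → remaining G X z ∧ adj G y z) z
             (∧-intro (∧-conicalˡ (remaining G X z) _ r) (∧-conicalʳ (S y) _ t))) of λ ()
    stays : ∀ k S → (∀ z → S z ≡ true → z ≡ y) → ∀ z → iterate G k (closeStep G (remaining G X)) S z ≡ true → z ≡ y
    stays zero    S h = h
    stays (suc k) S h = stays k _ (grow S h)

  -- One round of `closeStep` already reaches the neighbor `z`, and later rounds only add vertices.
  ⇒big : ∀ {X y} → Live X y → inBigComponent G X y ≡ true
  ⇒big {X} {y} (ry , z , rz , yz) = ∧-intro ry (T⇒≡ (≤⇒≤ᵇ (countF-lower _ (y ∷ z ∷ []) ((~⇒≢ yz ∷ []) ∷ [] ∷ [])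
      (reach y (inj₁ refl) ∷ reach z (inj₂ refl) ∷ []))))
    where
    T⇒≡ : ∀ {b} → Bool.T b → b ≡ true
    T⇒≡ {true} _ = refl
    S₀ : Subset n
    S₀ w = eqF w y ∧ remaining G X y
    persists : ∀ k S w → S w ≡ true → iterate G k (closeStep G (remaining G X)) S w ≡ true
    persists zero    S w p = p
    persists (suc k) S w p = persists k _ w (∨-introˡ p)
    y∈ : S₀ y ≡ true
    y∈ = ∧-intro (eqF-complete refl) ry
    first : ∀ w → w ≡ y ⊎ w ≡ z → closeStep G (remaining G X) S₀ w ≡ true
    first w (inj₁ refl) = ∨-introˡ y∈
    first w (inj₂ refl) = ∨-introʳ (S₀ z) (∧-intro rz (anyF-intro _ y (∧-intro y∈ yz)))
    deep : ∀ k → Fin k → ∀ w → w ≡ y ⊎ w ≡ z → iterate G k (closeStep G (remaining G X)) S₀ w ≡ true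
    deep (suc k) _ w h = persists k _ w (first w h)
    reach : ∀ w → w ≡ y ⊎ w ≡ z → component G X y w ≡ true
    -- There are `n` rounds, and the vertex `y` witnesses that `n` is positive.
    reach = deep n y

  initial : Subset n
  initial = inBigComponent G (λ _ → false)

  initial-intro : ∀ {a b} → a ~ b → a ∈ˢ initial
  initial-intro {a} {b} e = ⇒big (unplayed a , b , unplayed b , e)
    where
    unplayed : ∀ y → remaining G (λ _ → false) y ≡ true
    unplayed y = ⇒remaining {λ _ → false} {y} λ ()

  initial-closed : Closed initial
  initial-closed {z} p with _ , w , _ , e ← big⇒ {λ _ → false} p = w , initial-intro (~-sym e) , e

  insert-remaining⇒ : ∀ {X v z} → remaining G (insert G X v) z ≡ true → remaining G X z ≡ true × ¬ Dom v z
  insert-remaining⇒ {X} {v} p =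
    ⇒remaining (λ {x} q → remaining⇒ p (∨-introʳ (eqF x v) q)) , remaining⇒ p {v} (∨-introˡ (eqF-complete {i = v} refl))

  ⇒insert-remaining : ∀ {X v z} → remaining G X z ≡ true → ¬ Dom v z → remaining G (insert G X v) z ≡ true
  ⇒insert-remaining {X} {v} {z} p d = ⇒remaining λ {x} q → [ (λ e → subst (λ u → ¬ Dom u z) (sym (eqF-sound e)) d) , remaining⇒ p ]′ (∨-split (eqF x v) q)

  -- The course of the game depends on the selected set only through its live vertices, so from here
  -- on the selected set can be forgotten.
  after-big : ∀ X v z → after (inBigComponent G X) v z ≡ inBigComponent G (insert G X v) z
  after-big X v z = truth-ext to from
    where
    to : z ∈ˢ after (inBigComponent G X) v → inBigComponent G (insert G X v) z ≡ true
    to p with survives l s w zw lw sw ← after⇒ p =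
      ⇒big (⇒insert-remaining (proj₁ (big⇒ l)) s , w , ⇒insert-remaining (proj₁ (big⇒ lw)) sw , zw)
    from : inBigComponent G (insert G X v) z ≡ true → z ∈ˢ after (inBigComponent G X) v
    from p with rz , w , rw , zw ← big⇒ p
           with rz′ , sz ← insert-remaining⇒ {X} rz | rw′ , sw ← insert-remaining⇒ {X} rw =
      ⇒after (survives (⇒big (rz′ , w , rw′ , zw)) sz w zw (⇒big (rw′ , z , rz′ , ~-sym zw)) sw)

  after-cong : ∀ {L L′} → (∀ z → L z ≡ L′ z) → ∀ v z → after L v z ≡ after L′ v z
  after-cong {L} {L′} h v z = truth-ext (⇒after ∘ move h ∘ after⇒) (⇒after ∘ move (sym ∘ h) ∘ after⇒)
    where
    move : ∀ {L L′} → (∀ z → L z ≡ L′ z) → Survives L v z → Survives L′ v z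
    move h (survives l s w zw lw sw) = survives (trans (sym (h _)) l) s w zw (trans (sym (h _)) lw) sw

  playable⇒ : ∀ {X v} → playable G X v ≡ true → Playable (inBigComponent G X) v
  playable⇒ {X} {v} p with z , q ← anyF-witness (λ y → inBigComponent G X y ∧ (eqF v y ∨ adj G v y)) p =
    z , ∧-conicalˡ (inBigComponent G X z) _ q , domB-sound (∧-conicalʳ (inBigComponent G X z) _ q)

  ⇒playable : ∀ {X v} → Playable (inBigComponent G X) v → playable G X v ≡ true
  ⇒playable (z , l , d) = anyF-intro _ z (∧-intro l (domB-complete d))

  Playable-cong : ∀ {L L′ v} → (∀ z → L z ≡ L′ z) → Playable L v → Playable L′ v
  Playable-cong h (z , l , d) = z , trans (sym (h z)) l , d

  moves : Subset n → List (Fin n)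
  moves X = filter (λ x → playable G X x Bool.≟ true) (allFinL n)

  moves-intro : ∀ {X v} → playable G X v ≡ true → v ∈ moves X
  moves-intro {X} {v} p = ∈-filter⁺ (λ x → playable G X x Bool.≟ true) (all∈ v) p
    where
    all∈ : ∀ {n} (i : Fin n) → i ∈ allFinL n
    all∈ zero    = here refl
    all∈ (suc i) = there (∈-map⁺ suc (all∈ i))

  moves-elim : ∀ {X v} → v ∈ moves X → playable G X v ≡ true
  moves-elim {X} m = proj₂ (∈-filter⁻ (λ x → playable G X x Bool.≟ true) {xs = allFinL n} m)

  minL-lower : ∀ {a as} → a ∈ as → minL G as ≤ a
  minL-lower {a} {b ∷ bs} m = go b bs m
    where
    go : ∀ b bs → a ∈ b ∷ bs → foldr _⊓_ b bs ≤ a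
    go b []       (here refl)         = ≤-refl
    go b (c ∷ bs) (here refl)         = ≤-trans (m⊓n≤n c _) (go b bs (here refl))
    go b (c ∷ bs) (there (here refl)) = m⊓n≤m c _
    go b (c ∷ bs) (there (there m))   = ≤-trans (m⊓n≤n c _) (go b bs (there m))

  -- The membership premise excludes the empty list, on which `minL` has the default value 0.
  minL-greatest : ∀ {m a as} → a ∈ as → (∀ {b} → b ∈ as → m ≤ b) → m ≤ minL G as
  minL-greatest {m} {a} {b ∷ bs} _ h = go b bs h
    where
    go : ∀ b bs → (∀ {c} → c ∈ b ∷ bs → m ≤ c) → m ≤ foldr _⊓_ b bs
    go b []       h = h (here refl)
    go b (c ∷ bs) h = ⊓-glb (h (there (here refl))) (go b bs λ { (here e) → h (here e) ; (there q) → h (there (there q)) })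

  maxL-upper : ∀ {a as} → a ∈ as → a ≤ maxL G as
  maxL-upper {as = b ∷ bs} (here refl) = m≤m⊔n b _
  maxL-upper {as = b ∷ bs} (there m)   = ≤-trans (maxL-upper m) (m≤n⊔m b _)

  maxL-attained : ∀ a as → maxL G (a ∷ as) ∈ a ∷ as
  maxL-attained a []       = here (⊔-identityʳ a)
  maxL-attained a (b ∷ as) with ⊔-sel a (maxL G (b ∷ as))
  ... | inj₁ e = here e
  ... | inj₂ e = there (subst (_∈ b ∷ as) (sym e) (maxL-attained b as))

  maxL-mem : ∀ {a as} → a ∈ as → maxL G as ∈ as
  maxL-mem {as = b ∷ bs} _ = maxL-attained b bs

  -- Staller's move is read off an entry of the list of values that attains the maximum. `L` is tied
  -- to `X` only pointwise, so the induction can pass to `after L v` without function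
  -- extensionality.
  value⇒Force : ∀ f p X L m → (∀ z → inBigComponent G X z ≡ L z) → m ≤ gameValue G f p X → Force m p L
  value⇒Force f p X L zero h le = tt
  value⇒Force (suc f) p X L (suc m) h le with anyF (playable G X) in e
  value⇒Force (suc f) dominator X L (suc m) h le | true =
    (proj₁ some , Playable-cong h (playable⇒ (proj₂ some))) ,
    λ v pv → value⇒Force f staller (insert G X v) (after L v) m (next v)
      (≤-trans (s≤s⁻¹ le) (minL-lower (∈-map⁺ _ (moves-intro (⇒playable (Playable-cong (sym ∘ h) pv))))))
    where
    some = anyF-witness (playable G X) e
    next : ∀ v z → inBigComponent G (insert G X v) z ≡ after L v z
    next v z = trans (sym (after-big X v z)) (after-cong h v z)
  value⇒Force (suc f) staller X L (suc m) h le | true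
    with v , v∈ , eq ← ∈-map⁻ (λ x → gameValue G f dominator (insert G X x)) {xs = moves X} (maxL-mem (∈-map⁺ _ (moves-intro (proj₂ (anyF-witness (playable G X) e))))) =
    v , Playable-cong h (playable⇒ (moves-elim v∈)) ,
    value⇒Force f dominator (insert G X v) (after L v) m
      (λ z → trans (sym (after-big X v z)) (after-cong h v z)) (≤-trans (s≤s⁻¹ le) (≤-reflexive eq))

  -- Each forced move uses one unit of fuel, hence the condition `m ≤ f`.
  Force⇒value : ∀ f p X L m → (∀ z → inBigComponent G X z ≡ L z) → m ≤ f → Force m p L → m ≤ gameValue G f p X
  Force⇒value f p X L zero h le F = z≤n
  Force⇒value (suc f) p X L (suc m) h (s≤s le) F with anyF (playable G X) in e
  Force⇒value (suc f) dominator X L (suc m) h (s≤s le) ((u , pu) , F) | true =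
    s≤s (minL-greatest (∈-map⁺ _ (moves-intro (⇒playable (Playable-cong (sym ∘ h) pu)))) each)
    where
    each : ∀ {b} → b ∈ map (λ x → gameValue G f staller (insert G X x)) (moves X) → m ≤ b
    each b∈ with v , v∈ , refl ← ∈-map⁻ (λ x → gameValue G f staller (insert G X x)) b∈ =
      Force⇒value f staller (insert G X v) (after L v) m
        (λ z → trans (sym (after-big X v z)) (after-cong h v z)) le (F v (Playable-cong h (playable⇒ (moves-elim v∈))))
  Force⇒value (suc f) staller X L (suc m) h (s≤s le) (v , pv , F) | true =
    s≤s (≤-trans (Force⇒value f dominator (insert G X v) (after L v) m
        (λ z → trans (sym (after-big X v z)) (after-cong h v z)) le F)
      (maxL-upper (∈-map⁺ (λ x → gameValue G f dominator (insert G X x)) (moves-intro (⇒playable (Playable-cong (sym ∘ h) pv))))))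
  Force⇒value (suc f) dominator X L (suc m) h le ((u , pu) , F) | false =
    case trans (sym e) (anyF-intro (playable G X) u (⇒playable (Playable-cong (sym ∘ h) pu))) of λ ()
  Force⇒value (suc f) staller X L (suc m) h le (v , pv , F) | false =
    case trans (sym e) (anyF-intro (playable G X) v (⇒playable (Playable-cong (sym ∘ h) pv))) of λ ()

-- Counting removed vertices: the bound and tight positions

module Strategy {n : ℕ} (G : Graph n) where
  open Play G

  Killed : Subset n → Fin n → Fin n → Set
  Killed L v z = z ∈ˢ L × z ∉ˢ after L v

  dom-killed : ∀ {L v z} → z ∈ˢ L → Dom v z → Killed L v z
  dom-killed z∈ d = z∈ , λ p → Survives.safe (after⇒ p) d

  isolated-killed : ∀ {L v z} → z ∈ˢ L → (∀ {w} → w ∈ˢ L → z ~ w → Dom v w) → Killed L v z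
  isolated-killed z∈ h = z∈ , λ p → case after⇒ p of λ { (survives _ _ w zw w∈ sw) → sw (h w∈ zw) }

  kill-gap : ∀ {L v} zs → Unique zs → All (Killed L v) zs → length zs + countF (after L v) ≤ countF L
  kill-gap {L} {v} zs = countF-gap (after L v) L zs λ z → after⊆

  -- `a` and `b` may be adjacent, so that paths on three vertices and triangles are handled
  -- together.
  record Mid (L : Subset n) (v a b : Fin n) : Set where
    constructor mid
    field
      v∈  : v ∈ˢ L
      a∈  : a ∈ˢ L
      b∈  : b ∈ˢ L
      v~a : v ~ a
      v~b : v ~ b
      a≢b : a ≢ b

  swap-mid : ∀ {L v a b} → Mid L v a b → Mid L v b a
  swap-mid (mid v∈ a∈ b∈ va vb ab) = mid v∈ b∈ a∈ vb va (≢-sym ab)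

  mid-dec : ∀ L v a b → Dec (Mid L v a b)
  mid-dec L v a b =
    map′ (λ (v∈ , a∈ , b∈ , va , vb , ab) → mid v∈ a∈ b∈ va vb ab)
         (λ (mid v∈ a∈ b∈ va vb ab) → v∈ , a∈ , b∈ , va , vb , ab)
         ((L v Bool.≟ true) ×-dec (L a Bool.≟ true) ×-dec (L b Bool.≟ true) ×-dec
          (adj G v a Bool.≟ true) ×-dec (adj G v b Bool.≟ true) ×-dec ¬? (a ≟ b))

  HasMid : Subset n → Set
  HasMid L = ∃ λ v → ∃ λ a → ∃ λ b → Mid L v a b

  mid? : ∀ L → Dec (HasMid L)
  mid? L = any? λ v → any? λ a → any? λ b → mid-dec L v a b

  mid-uniq : ∀ {L v a b} → Mid L v a b → Unique (v ∷ a ∷ b ∷ [])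
  mid-uniq M = uniq3 (~⇒≢ (Mid.v~a M)) (~⇒≢ (Mid.v~b M)) (Mid.a≢b M)

  mid-killed : ∀ {L v a b} → Mid L v a b → All (Killed L v) (v ∷ a ∷ b ∷ [])
  mid-killed (mid v∈ a∈ b∈ va vb ab) =
    dom-killed v∈ (inj₁ refl) ∷ dom-killed a∈ (inj₂ va) ∷ dom-killed b∈ (inj₂ vb) ∷ []

  kill-one : ∀ {L v} → Playable L v → suc (countF (after L v)) ≤ countF L
  kill-one (z , z∈ , d) = kill-gap (z ∷ []) ([] ∷ []) (dom-killed z∈ d ∷ [])

  -- In a matching `z` is the only live neighbor of its mate `w`, so dominating `z` isolates `w` if
  -- it does not dominate it.
  kill-pair : ∀ {L v} → Closed L → ¬ HasMid L → Playable L v → 2 + countF (after L v) ≤ countF L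
  kill-pair {L} {v} cl nm (z , z∈ , d) with w , w∈ , zw ← cl z∈ =
    kill-gap (z ∷ w ∷ []) ((~⇒≢ zw ∷ []) ∷ [] ∷ [])
      (dom-killed z∈ d ∷ isolated-killed w∈ only ∷ [])
    where
    only : ∀ {y} → y ∈ˢ L → w ~ y → Dom v y
    only {y} y∈ wy with y ≟ z
    ... | yes refl = d
    ... | no y≢z   = ⊥-elim (nm (w , y , z , mid w∈ y∈ z∈ wy (~-sym zw) y≢z))

  double-2+ : ∀ m → 2 * (2 + m) ≡ 4 + 2 * m
  double-2+ = *-distribˡ-+ 2 2

  -- Dominator keeps removing a vertex of degree at least two together with two of its neighbors
  -- while there is one; afterwards every move of either player removes a whole edge.
  force-bound : ∀ m {L} → Closed L → Force m dominator L → 2 * m ≤ countF L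
  force-bound zero cl F = z≤n
  force-bound (suc zero) {L} cl ((_ , z , z∈ , _) , _) with w , w∈ , zw ← cl z∈ =
    countF-lower L (z ∷ w ∷ []) ((~⇒≢ zw ∷ []) ∷ [] ∷ []) (z∈ ∷ w∈ ∷ [])
  force-bound (suc (suc m)) {L} cl ((u , pu) , F) with mid? L
  ... | yes (v , a , b , M) with s , ps , F′ ← F v (v , Mid.v∈ M , inj₁ refl) = begin
    2 * (2 + m)                            ≡⟨ double-2+ m ⟩
    4 + 2 * m                              ≤⟨ +-monoʳ-≤ 4 (force-bound m after-closed F′) ⟩
    4 + countF (after (after L v) s)       ≤⟨ +-monoʳ-≤ 3 (kill-one ps) ⟩
    3 + countF (after L v)                 ≤⟨ kill-gap _ (mid-uniq M) (mid-killed M) ⟩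
    countF L                               ∎
    where open ≤-Reasoning
  ... | no nm with s , ps , F′ ← F u pu = begin
    2 * (2 + m)                            ≡⟨ double-2+ m ⟩
    4 + 2 * m                              ≤⟨ +-monoʳ-≤ 4 (force-bound m after-closed F′) ⟩
    4 + countF (after (after L u) s)       ≤⟨ +-monoʳ-≤ 2 (kill-pair after-closed nm′ ps) ⟩
    2 + countF (after L u)                 ≤⟨ kill-pair cl nm pu ⟩
    countF L                               ∎
    where
    open ≤-Reasoning
    nm′ : ¬ HasMid (after L u)
    nm′ (v , a , b , mid v∈ a∈ b∈ va vb ab) =
      nm (v , a , b , mid (after⊆ v∈) (after⊆ a∈) (after⊆ b∈) va vb ab)

  -- The opening move differs from later ones in that every vertex with a neighbor is still live, so
  -- the selected vertex is removed along with a neighbor.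
  initial-bound : ∀ m {L} → (∀ {a b} → a ~ b → a ∈ˢ L) → Closed L → Force m staller L → 2 * m ≤ countF L
  initial-bound zero full cl F = z≤n
  initial-bound (suc m) {L} full cl (v , (z , z∈ , d) , F) = begin
    2 * suc m                ≡⟨ *-suc 2 m ⟩
    2 + 2 * m                ≤⟨ +-monoʳ-≤ 2 (force-bound m after-closed F) ⟩
    2 + countF (after L v)   ≤⟨ two d ⟩
    countF L                 ∎
    where
    open ≤-Reasoning
    two : Dom v z → 2 + countF (after L v) ≤ countF L
    two (inj₂ vz) = kill-gap (v ∷ z ∷ []) ((~⇒≢ vz ∷ []) ∷ [] ∷ [])
      (dom-killed (full vz) (inj₁ refl) ∷ dom-killed z∈ (inj₂ vz) ∷ [])
    two (inj₁ refl) with w , w∈ , vw ← cl z∈ = kill-gap (v ∷ w ∷ []) ((~⇒≢ vw ∷ []) ∷ [] ∷ [])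
      (dom-killed z∈ (inj₁ refl) ∷ dom-killed w∈ (inj₂ vw) ∷ [])

  record Tight (m : ℕ) (L : Subset n) : Set where
    constructor tight
    field
      closed : Closed L
      force  : Force m dominator L
      card   : countF L ≤ 2 * m

  tight-card : ∀ {m L} → Tight m L → countF L ≡ 2 * m
  tight-card {m} (tight cl F c) = ≤-antisym c (force-bound m cl F)

  tight-lower : ∀ {m L} → Tight m L → ∀ zs → Unique zs → All (_∈ˢ L) zs → length zs ≤ 2 * m
  tight-lower t zs u as = ≤-trans (countF-lower _ zs u as) (Tight.card t)

  -- The list holds the vertices lost in one pair of moves; what matters about the remainder is that
  -- it is tight for two moves fewer.
  record Rest (m : ℕ) (L : Subset n) (zs : List (Fin n)) : Set where
    field
      rest   : Subset n
      rest⇒∈ : ∀ {z} → z ∈ˢ rest → z ∈ˢ L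
      rest⇒∉ : ∀ {z} → z ∈ˢ rest → z ∉ zs
      ⇒rest  : ∀ {z} → z ∈ˢ L → z ∉ zs → z ∈ˢ rest
      still  : Tight m rest

  record Reply (m : ℕ) (L : Subset n) (v : Fin n) (zs : List (Fin n)) : Set where
    field
      s w  : Fin n
      s~w  : s ~ w
      w∈   : w ∈ˢ L
      w∉   : w ∉ zs
      only : ∀ {z} → z ∈ˢ L → z ∉ zs → Dom s z → z ≡ w
      free : ∀ {z} → z ∈ˢ L → z ∉ zs → ¬ Dom v z
      rem  : Rest m L (w ∷ zs)

  relist : ∀ {m L zs zs′} → (∀ {z} → z ∉ zs → z ∉ zs′) → (∀ {z} → z ∉ zs′ → z ∉ zs) → Rest m L zs → Rest m L zs′
  relist f g R = record
    { rest = rest ; rest⇒∈ = rest⇒∈ ; rest⇒∉ = f ∘ rest⇒∉ ; ⇒rest = λ z∈ z∉ → ⇒rest z∈ (g z∉) ; still = still }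
    where open Rest R

  module Tight₂ {m : ℕ} {L : Subset n} (t : Tight (2 + m) L) where
    open Tight t

    staller-reply : ∀ {v} → Playable L v → Σ (Fin n) λ s → Playable (after L v) s × Force m dominator (after (after L v) s)
    staller-reply {v} = proj₂ force v

    -- Four vertices lost to Dominator and at least one to the reply leave fewer than the `2 * m`
    -- that `force-bound` requires.
    no-four : ∀ {v} zs → length zs ≡ 4 → Unique zs → All (Killed L v) zs → Playable L v → ⊥
    no-four {v} zs l u ks pv with s , ps , F ← staller-reply pv = 1+n≰n (begin
      5 + 2 * m                               ≤⟨ +-monoʳ-≤ 5 (force-bound m after-closed F) ⟩
      5 + countF (after (after L v) s)        ≤⟨ +-monoʳ-≤ 4 (kill-one ps) ⟩
      4 + countF (after L v)                  ≡⟨ cong (_+ countF (after L v)) (sym l) ⟩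
      length zs + countF (after L v)          ≤⟨ kill-gap zs u ks ⟩
      countF L                                ≤⟨ card ⟩
      2 * (2 + m)                             ≡⟨ double-2+ m ⟩
      4 + 2 * m                               ∎)
      where open ≤-Reasoning

    no-five : ∀ {v s} zs → length zs ≡ 3 → Unique zs → All (Killed L v) zs → Force m dominator (after (after L v) s) →
      ∀ {w w′} → Killed (after L v) s w → Killed (after L v) s w′ → w ≢ w′ → ⊥
    no-five {v} {s} zs l u ks F {w} {w′} k k′ ne = 1+n≰n (begin
      5 + 2 * m                               ≤⟨ +-monoʳ-≤ 5 (force-bound m after-closed F) ⟩
      5 + countF (after (after L v) s)        ≤⟨ +-monoʳ-≤ 3 (kill-gap (w ∷ w′ ∷ []) ((ne ∷ []) ∷ [] ∷ []) (k ∷ k′ ∷ [])) ⟩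
      3 + countF (after L v)                  ≡⟨ cong (_+ countF (after L v)) (sym l) ⟩
      length zs + countF (after L v)          ≤⟨ kill-gap zs u ks ⟩
      countF L                                ≤⟨ card ⟩
      2 * (2 + m)                             ≡⟨ double-2+ m ⟩
      4 + 2 * m                               ∎)
      where open ≤-Reasoning

    -- After a Dominator move removing three vertices, Staller must remove exactly one.
    reply : ∀ {v} a b c → Unique (a ∷ b ∷ c ∷ []) → All (Killed L v) (a ∷ b ∷ c ∷ []) → Playable L v →
      Reply m L v (a ∷ b ∷ c ∷ [])
    reply {v} a b c u ks pv with s , ps@(w , w∈′ , sw) , F ← staller-reply pv = record
      { s = s ; w = w
      ; s~w = [ (λ { refl → ⊥-elim (self refl) }) , (λ e → e) ]′ sw
      ; w∈ = after⊆ w∈′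
      ; w∉ = after⇒∉ w∈′
      ; only = λ z∈ z∉ d → case _ ≟ w of λ
          { (yes e) → e ; (no ne) → ⊥-elim (no-five zs refl u ks F (dom-killed (alive z∈ z∉) d) (dom-killed w∈′ sw) ne) }
      ; free = λ z∈ z∉ → Survives.safe (after⇒ (alive z∈ z∉))
      ; rem = record
        { rest = L″
        ; rest⇒∈ = after⊆ ∘ after⊆
        ; rest⇒∉ = λ p → (λ { refl → proj₂ (dom-killed w∈′ sw) p }) ∷ after⇒∉ (after⊆ p)
        ; ⇒rest = λ { z∈ (ne ∷ z∉) → alive₂ z∈ ne z∉ }
        ; still = tight after-closed F small
        }
      }
      where
      open ≤-Reasoning
      zs = a ∷ b ∷ c ∷ []
      L″ = after (after L v) s
      after⇒∉ : ∀ {z} → z ∈ˢ after L v → z ∉ zs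
      after⇒∉ {z} p = All.map (λ { k refl → proj₂ k p }) ks
      alive : ∀ {z} → z ∈ˢ L → z ∉ zs → z ∈ˢ after L v
      alive {z} z∈ z∉ with after L v z Bool.≟ true
      ... | yes p = p
      ... | no ¬p = ⊥-elim (no-four (z ∷ zs) refl (z∉ ∷ u) ((z∈ , ¬p) ∷ ks) pv)
      alive₂ : ∀ {z} → z ∈ˢ L → z ≢ w → z ∉ zs → z ∈ˢ L″
      alive₂ {z} z∈ ne z∉ with L″ z Bool.≟ true
      ... | yes p = p
      ... | no ¬p = ⊥-elim (no-five zs refl u ks F (alive z∈ z∉ , ¬p) (dom-killed w∈′ sw) ne)
      -- A reply that is itself live also removes a live neighbor, hence two vertices.
      self : s ≡ w → ⊥
      self refl with y , y∈ , wy ← after-closed w∈′ =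
        no-five zs refl u ks F (dom-killed w∈′ (inj₁ refl)) (dom-killed y∈ (inj₂ wy)) (~⇒≢ wy)
      small : countF L″ ≤ 2 * m
      small = +-cancelˡ-≤ 4 _ _ (begin
        4 + countF L″             ≤⟨ +-monoʳ-≤ 3 (kill-one ps) ⟩
        3 + countF (after L v)    ≤⟨ kill-gap zs u ks ⟩
        countF L                  ≤⟨ card ⟩
        2 * (2 + m)               ≡⟨ double-2+ m ⟩
        4 + 2 * m                 ∎)

    -- A third live neighbor would be a fourth vertex removed when Dominator plays `v`.
    nbr : ∀ {v a b z} → Mid L v a b → z ∈ˢ L → v ~ z → z ≡ a ⊎ z ≡ b
    nbr {v} {a} {b} {z} M z∈ vz with z ≟ a | z ≟ b
    ... | yes e | _     = inj₁ e
    ... | no _  | yes e = inj₂ e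
    ... | no za | no zb = ⊥-elim (no-four (z ∷ v ∷ a ∷ b ∷ []) refl
      ((≢-sym (~⇒≢ vz) ∷ za ∷ zb ∷ []) ∷ mid-uniq M) (dom-killed z∈ (inj₂ vz) ∷ mid-killed M) (v , Mid.v∈ M , inj₁ refl))

    -- Otherwise Dominator playing `v` would isolate `z` or dominate it, a fourth loss. This is what
    -- lets paths be extended.
    keep : ∀ {v a b z} → Mid L v a b → z ∈ˢ L → z ∉ v ∷ a ∷ b ∷ [] →
      Σ (Fin n) λ w → w ∈ˢ L × z ~ w × w ∉ v ∷ a ∷ b ∷ []
    keep {v} {a} {b} {z} M z∈ z∉ with after L v z Bool.≟ true
    ... | no ¬p = ⊥-elim (no-four (z ∷ v ∷ a ∷ b ∷ []) refl (z∉ ∷ mid-uniq M) ((z∈ , ¬p) ∷ mid-killed M) (v , Mid.v∈ M , inj₁ refl))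
    ... | yes p with survives _ _ w zw w∈ sw ← after⇒ p =
      w , w∈ , zw , ((sw ∘ inj₁ ∘ sym) ∷ (λ { refl → sw (inj₂ (Mid.v~a M)) }) ∷ (λ { refl → sw (inj₂ (Mid.v~b M)) }) ∷ [])

    mid-reply : ∀ {v a b} → Mid L v a b → Reply m L v (v ∷ a ∷ b ∷ [])
    mid-reply {v} M = reply _ _ _ (mid-uniq M) (mid-killed M) (v , Mid.v∈ M , inj₁ refl)

    -- Dominator could play p₃ and remove the end p₁ of such a path as well.
    no-pendant-path : ∀ {p₁ p₂ p₃ p₄} → p₁ ∈ˢ L → p₂ ∈ˢ L → p₃ ∈ˢ L → p₄ ∈ˢ L →
      (∀ {z} → z ∈ˢ L → p₁ ~ z → z ≡ p₂) → p₂ ~ p₃ → p₃ ~ p₄ → p₁ ≢ p₂ → p₁ ≢ p₃ → p₁ ≢ p₄ → p₂ ≢ p₄ → ⊥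
    no-pendant-path i₁ i₂ i₃ i₄ end p23 p34 n12 n13 n14 n24
      with w , w∈ , e , (_ ∷ ne ∷ _) ← keep (mid i₃ i₂ i₄ (~-sym p23) p34 n24) i₁ (n13 ∷ n12 ∷ n14 ∷ []) = ne (end w∈ e)

-- Long paths and cycles of live vertices

module Chains {n : ℕ} (G : Graph n) where
  open Play G
  open Strategy G

  -- The statement is for every `m` because it is applied to remainders in which fewer than two
  -- moves may be left; there three live vertices are already too many.
  pendant-path : ∀ {m L} → Tight m L → ∀ {p₁ p₂ p₃ p₄} → p₁ ∈ˢ L → p₂ ∈ˢ L → p₃ ∈ˢ L → p₄ ∈ˢ L →
    (∀ {z} → z ∈ˢ L → p₁ ~ z → z ≡ p₂) → p₂ ~ p₃ → p₃ ~ p₄ → p₁ ≢ p₂ → p₁ ≢ p₃ → p₁ ≢ p₄ → p₂ ≢ p₄ → ⊥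
  pendant-path {suc (suc m)} t = Tight₂.no-pendant-path t
  pendant-path {0} t i₁ i₂ i₃ i₄ _ e _ n12 n13 _ _ =
    case tight-lower t _ (uniq3 n12 n13 (~⇒≢ e)) (i₁ ∷ i₂ ∷ i₃ ∷ []) of λ ()
  pendant-path {1} t i₁ i₂ i₃ i₄ _ e _ n12 n13 _ _ =
    case tight-lower t _ (uniq3 n12 n13 (~⇒≢ e)) (i₁ ∷ i₂ ∷ i₃ ∷ []) of λ { (s≤s (s≤s ())) }

  record Long (L : Subset n) : Set where
    field
      c₀ c₁ c₂ c₃ c₄ : Fin n
      m₁ : Mid L c₁ c₀ c₂
      m₂ : Mid L c₂ c₁ c₃
      m₃ : Mid L c₃ c₂ c₄
      n₀₃ : c₀ ≢ c₃
      n₁₄ : c₁ ≢ c₄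
      n₀₄ : c₀ ≢ c₄
  open Long

  flip : ∀ {L} → Long L → Long L
  flip p = record
    { c₀ = c₄ p ; c₁ = c₃ p ; c₂ = c₂ p ; c₃ = c₁ p ; c₄ = c₀ p
    ; m₁ = swap-mid (m₃ p) ; m₂ = swap-mid (m₂ p) ; m₃ = swap-mid (m₁ p)
    ; n₀₃ = ≢-sym (n₁₄ p) ; n₁₄ = ≢-sym (n₀₃ p) ; n₀₄ = ≢-sym (n₀₄ p) }

  module Walking {m : ℕ} {L : Subset n} (t : Tight (2 + m) L) where
    open Tight₂ t

    -- Dominator playing the middle vertex `c₂` must not isolate `c₄`. The further neighbor avoids
    -- `c₁`, `c₂`, `c₃` but may be `c₀`, in which case the path closes to a pentagon.
    next : (p : Long L) → Σ (Fin n) λ w → w ∈ˢ L × c₄ p ~ w × w ∉ c₂ p ∷ c₁ p ∷ c₃ p ∷ []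
    next p = keep (m₂ p) (Mid.b∈ (m₃ p)) (≢-sym (Mid.a≢b (m₃ p)) ∷ ≢-sym (n₁₄ p) ∷ ≢-sym (~⇒≢ (Mid.v~b (m₃ p))) ∷ [])

    shift : Long L → Long L
    shift p = record
      { c₀ = c₁ p ; c₁ = c₂ p ; c₂ = c₃ p ; c₃ = c₄ p ; c₄ = proj₁ (next p)
      ; m₁ = m₂ p ; m₂ = m₃ p
      ; m₃ = mid (Mid.b∈ (m₃ p)) (Mid.v∈ (m₃ p)) (proj₁ (proj₂ (next p))) (~-sym (Mid.v~b (m₃ p)))
               (proj₁ (proj₂ (proj₂ (next p)))) (≢-sym (All.lookup (proj₂ (proj₂ (proj₂ (next p)))) (there (there (here refl)))))
      ; n₀₃ = n₁₄ p
      ; n₁₄ = ≢-sym (All.lookup (proj₂ (proj₂ (proj₂ (next p)))) (here refl))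
      ; n₀₄ = ≢-sym (All.lookup (proj₂ (proj₂ (proj₂ (next p)))) (there (here refl))) }

    back : Long L → Long L
    back = flip ∘ shift ∘ flip

    LongAt : Fin n → Set
    LongAt v = Σ (Long L) λ p → c₂ p ≡ v

    -- Makes `LongAt` a property of whole components, the form in which `escape` uses it.
    longAt-nbr : ∀ {v z} → LongAt v → z ∈ˢ L → v ~ z → LongAt z
    longAt-nbr (p , refl) z∈ e with nbr (m₂ p) z∈ e
    ... | inj₁ refl = back p , refl
    ... | inj₂ refl = shift p , refl

    -- `keep` at `v` supplies a vertex `a₃` beyond `a₂`; the window `b`, `v`, `a`, `a₂`, `a₃` is
    -- then moved back by one to put `v` in the middle.
    extend-mid : ∀ {v a b a₂} → Mid L v a b → a₂ ∈ˢ L → a ~ a₂ → a₂ ∉ v ∷ a ∷ b ∷ [] → LongAt v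
    extend-mid {v} {a} {b} {a₂} M a₂∈ aa₂ a₂∉@(nv ∷ _ ∷ nb ∷ [])
      with a₃ , a₃∈ , e , (ov ∷ oa ∷ ob ∷ []) ← keep M a₂∈ a₂∉ = back (record
      { c₀ = b ; c₁ = v ; c₂ = a ; c₃ = a₂ ; c₄ = a₃
      ; m₁ = swap-mid M
      ; m₂ = mid (Mid.a∈ M) (Mid.v∈ M) a₂∈ (~-sym (Mid.v~a M)) aa₂ (≢-sym nv)
      ; m₃ = mid a₂∈ (Mid.a∈ M) a₃∈ (~-sym aa₂) e (≢-sym oa)
      ; n₀₃ = ≢-sym nb ; n₁₄ = ≢-sym ov ; n₀₄ = ≢-sym ob }) , refl

    -- An infinite walk in which any five consecutive vertices are distinct. Indexing by natural
    -- numbers leaves the length of the cycle open until a coincidence of two terms determines it.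
    record Chain : Set where
      field
        c  : ℕ → Fin n
        md : ∀ i → Mid L (c (1 + i)) (c i) (c (2 + i))
        n₃ : ∀ i → c i ≢ c (3 + i)
        n₄ : ∀ i → c i ≢ c (4 + i)

      c∈ : ∀ i → c i ∈ˢ L
      c∈ i = Mid.a∈ (md i)

      e : ∀ i → c i ~ c (1 + i)
      e i = ~-sym (Mid.v~a (md i))

      n₁ : ∀ i → c i ≢ c (1 + i)
      n₁ i = ~⇒≢ (e i)

      n₂ : ∀ i → c i ≢ c (2 + i)
      n₂ i = Mid.a≢b (md i)

      back~ : ∀ i {z} → c (1 + i) ≡ z → z ~ c i
      back~ i refl = Mid.v~a (md i)

    drop : ℕ → Chain → Chain
    drop j C = record { c = λ i → c (i + j) ; md = λ i → md (i + j) ; n₃ = λ i → n₃ (i + j) ; n₄ = λ i → n₄ (i + j) }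
      where open Chain C

    iter : ℕ → Long L → Long L
    iter zero    p = p
    iter (suc i) p = shift (iter i p)

    chain : (p : Long L) → Σ Chain λ C → Chain.c C 2 ≡ c₂ p
    chain p = record
      { c = λ i → c₀ (iter i p) ; md = λ i → m₁ (iter i p) ; n₃ = λ i → n₀₃ (iter i p) ; n₄ = λ i → n₀₄ (iter i p) } , refl

    -- Staller's answer to a Dominator move on a long cycle, if it comes from the cycle itself,
    -- removes four consecutive vertices of it.
    Block : Chain → Set
    Block C = Rest m L (c 0 ∷ c 1 ∷ c 2 ∷ c 3 ∷ [])
      where open Chain C using (c)

    Per : ℕ → Chain → Set
    Per k C = Chain.c C k ≡ Chain.c C 0

    -- After the deletion `c 4` keeps only the neighbor `c 5`. If `c 6` and `c 7` also survived,
    -- `c 4` to `c 7` would be a pendant path in a tight remainder; so one of them is a deleted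
    -- vertex, and degree two leaves only `c 0`.
    block-period : (C : Chain) → Block C → Per 6 C ⊎ Per 7 C
    block-period C B = cases (locate (c 6) ds)
      where
      open Chain C
      open Rest B
      ds = c 0 ∷ c 1 ∷ c 2 ∷ c 3 ∷ []
      dead : ∀ {z} → z ∈ ds → z ∈ˢ rest → ⊥
      dead m z∈ = All.lookup (rest⇒∉ z∈) m refl
      i₄ : c 4 ∈ˢ rest
      i₄ = ⇒rest (c∈ 4) (≢-sym (n₄ 0) ∷ ≢-sym (n₃ 1) ∷ ≢-sym (n₂ 2) ∷ ≢-sym (n₁ 3) ∷ [])
      end : ∀ {z} → z ∈ˢ rest → c 4 ~ z → z ≡ c 5
      end z∈ f with nbr (md 3) (rest⇒∈ z∈) f
      ... | inj₁ refl = ⊥-elim (dead (there (there (there (here refl)))) z∈)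
      ... | inj₂ q = q
      -- This rules out length five, where `c 4` would be left without a live neighbor.
      i₅ : c 5 ∈ˢ rest
      i₅ with z , z∈ , f ← Tight.closed still i₄ = subst (_∈ˢ rest) (end z∈ f) z∈
      inner : ∀ i {z} → c i ∈ ds → c (2 + i) ∈ ds → z ∈ˢ rest → ¬ c (1 + i) ~ z
      inner i d d′ z∈ f with nbr (md i) (rest⇒∈ z∈) f
      ... | inj₁ refl = dead d z∈
      ... | inj₂ refl = dead d′ z∈
      at₁ : ∀ {z} → z ∈ˢ rest → ¬ c 1 ~ z
      at₁ = inner 0 (here refl) (there (there (here refl)))
      at₂ : ∀ {z} → z ∈ˢ rest → ¬ c 2 ~ z
      at₂ = inner 1 (there (here refl)) (there (there (there (here refl))))
      cases₇ : c 6 ∈ˢ rest → c 7 ∈ ds ⊎ c 7 ∉ ds → Per 6 C ⊎ Per 7 C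
      cases₇ i₆ (inj₁ (here q)) = inj₂ q
      cases₇ i₆ (inj₁ (there (here q))) = ⊥-elim (at₁ i₆ (back~ 6 q))
      cases₇ i₆ (inj₁ (there (there (here q)))) = ⊥-elim (at₂ i₆ (back~ 6 q))
      cases₇ i₆ (inj₁ (there (there (there (here q))))) = ⊥-elim (n₄ 3 (sym q))
      cases₇ i₆ (inj₂ o) = ⊥-elim (pendant-path still i₄ i₅ i₆ (⇒rest (c∈ 7) o) end
        (e 5) (e 6) (n₁ 4) (n₂ 4) (n₃ 4) (n₂ 5))
      cases : c 6 ∈ ds ⊎ c 6 ∉ ds → Per 6 C ⊎ Per 7 C
      cases (inj₁ (here q)) = inj₁ q
      cases (inj₁ (there (here q))) = ⊥-elim (at₁ i₅ (back~ 5 q))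
      cases (inj₁ (there (there (here q)))) = ⊥-elim (n₄ 2 (sym q))
      cases (inj₁ (there (there (there (here q))))) = ⊥-elim (n₃ 3 (sym q))
      cases (inj₂ o) = cases₇ (⇒rest (c∈ 6) o) (locate (c 7) ds)

    -- The index is one less than the length of the cycle.
    data Period : ℕ → Set where
      five  : Period 4
      six   : Period 5
      seven : Period 6

    -- The cyclic order could only reverse at the wrap-around, and then two vertices
    -- at distance at most four on the chain would coincide.
    per-shift : ∀ {k} → Period k → (C : Chain) → Per (suc k) C → Per (suc k) (drop 1 C)
    per-shift five C p with nbr (md 4) (c∈ 1) (subst (_~ c 1) (sym p) (e 0))
      where open Chain C
    ... | inj₂ q = sym q
    ... | inj₁ q = ⊥-elim (Chain.n₃ C 1 q)
    per-shift six C p with nbr (md 5) (c∈ 1) (subst (_~ c 1) (sym p) (e 0))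
      where open Chain C
    ... | inj₂ q = sym q
    ... | inj₁ q = ⊥-elim (Chain.n₄ C 1 q)
    per-shift seven C p with nbr (md 6) (c∈ 1) (subst (_~ c 1) (sym p) (e 0))
      where open Chain C
    ... | inj₂ q = sym q
    ... | inj₁ q with nbr (Chain.md C 0) (Chain.c∈ C 5) (Chain.back~ C 5 (sym q))
    ...   | inj₁ r = ⊥-elim (Chain.n₂ C 5 (trans r (sym p)))
    ...   | inj₂ r = ⊥-elim (Chain.n₃ C 2 (sym r))

    module Ring {k : ℕ} (P : Period k) (C : Chain) (per : Per (suc k) C) where
      open Chain C

      periodic : ∀ i → c (suc k + i) ≡ c i
      periodic = go P C per
        where
        go : ∀ {k} → Period k → (C : Chain) → Per (suc k) C → ∀ i → Chain.c C (suc k + i) ≡ Chain.c C i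
        go five  C p zero    = p
        go six   C p zero    = p
        go seven C p zero    = p
        go five  C p (suc i) = per-shift five  (drop i C) (go five  C p i)
        go six   C p (suc i) = per-shift six   (drop i C) (go six   C p i)
        go seven C p (suc i) = per-shift seven (drop i C) (go seven C p i)

      OnC : Fin n → Set
      OnC z = Σ ℕ λ i → z ≡ c i

      -- One turn has length `suc k`, so `c (k + i)` is the predecessor of `c i`, written without
      -- subtraction.
      ring-mid : ∀ i → Mid L (c i) (c (k + i)) (c (suc i))
      ring-mid i = subst (λ v → Mid L v (c (k + i)) (c (suc i))) (periodic i)
        (subst (Mid L (c (suc k + i)) (c (k + i)))
          (trans (cong c (sym (+-suc′ k i))) (periodic (suc i))) (md (k + i)))
        where
        +-suc′ : ∀ k i → suc k + suc i ≡ suc (suc k + i)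
        +-suc′ k i = cong suc (trans (+-comm k (suc i)) (cong suc (+-comm i k)))

      onC-nbr : ∀ {z w} → OnC z → w ∈ˢ L → z ~ w → OnC w
      onC-nbr (i , refl) w∈ e with nbr (ring-mid i) w∈ e
      ... | inj₁ q = k + i , q
      ... | inj₂ q = suc i , q

      ring : List (Fin n)
      ring = applyUpTo c (suc k)

      onC⇒ring : ∀ {z} → OnC z → z ∈ ring
      onC⇒ring (i , refl) = subst (_∈ ring) (sym reduce) (∈-applyUpTo⁺ c (m%n<n i (suc k)))
        where
        turns : ∀ q r → c (r + q * suc k) ≡ c r
        turns zero    r = cong c (+-comm r 0)
        turns (suc q) r = trans (cong c (rearrange r (suc k) (q * suc k))) (trans (periodic (r + q * suc k)) (turns q r))
          where
          rearrange : ∀ a b c → a + (b + c) ≡ b + (a + c)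
          rearrange a b c = trans (sym (+-assoc a b c)) (trans (cong (_+ c) (+-comm a b)) (+-assoc b a c))
        reduce : c i ≡ c (i % suc k)
        reduce = trans (cong c (m≡m%n+[m/n]*n i (suc k))) (turns (i / suc k) (i % suc k))

      ring⇒onC : ∀ {z} → z ∈ ring → OnC z
      ring⇒onC m with i , _ , e ← ∈-applyUpTo⁻ c m = i , e

      onC? : ∀ z → Dec (OnC z)
      onC? z with locate z ring
      ... | inj₁ m = yes (ring⇒onC m)
      ... | inj₂ o = no λ q → All.lookup o (onC⇒ring q) refl

-- The position after Staller has selected the leaf x with neighbor y.

module Escape {n : ℕ} (G : Graph n) {L : Subset n}
  (x y : Fin n) (y∉ : y ∉ˢ L) (full : ∀ {z} → z ≢ x → z ≢ y → z ∈ˢ L)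
  (leaf : ∀ {z} → adj G x z ≡ true → z ≡ y) (walk : ∀ z → Walk G z y) where

  open Play G
  open Strategy G

  -- A walk to `y` stays in `S` while it stays among live vertices, and from a live vertex it cannot
  -- enter the leaf `x`. So each union of components of the live graph has an edge to `y`.
  escape : (S : Fin n → Set) → (∀ {z z′} → S z → z ∈ˢ L → z′ ∈ˢ L → z ~ z′ → S z′) →
    ∀ {z} → S z → z ∈ˢ L → Σ (Fin n) λ u → S u × u ∈ˢ L × y ~ u
  escape S cl {z} sz z∈ = go (walk z) sz z∈
    where
    go : ∀ {z} → Walk G z y → S z → z ∈ˢ L → Σ (Fin n) λ u → S u × u ∈ˢ L × y ~ u
    go here sz z∈ = ⊥-elim (y∉ z∈)
    go {z} (step {j = z′} e r) sz z∈ with z′ ≟ y | z′ ≟ x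
    ... | yes refl | _ = z , sz , z∈ , ~-sym e
    ... | no _  | yes refl = ⊥-elim (y∉ (subst (_∈ˢ L) (leaf (~-sym e)) z∈))
    ... | no ny | no nx = go r (cl sz z∈ (full nx ny) e) (full nx ny)

module Leaf {n : ℕ} (G : Graph n) {m : ℕ} {L : Subset n} (t : Strategy.Tight G (2 + m) L)
  (x y : Fin n) (y∉ : y ∉ˢ L) (full : ∀ {z} → z ≢ x → z ≢ y → z ∈ˢ L)
  (leaf : ∀ {z} → adj G x z ≡ true → z ≡ y) (walk : ∀ z → Walk G z y) where

  open Play G
  open Strategy G

  open Escape G x y y∉ full leaf walk
  open Chains G
  open Walking t
  open Tight₂ t

  -- Staller's reply vertex is outside the part left over, so it is y or one of the vertices just removed.
  reply-source : ∀ {v zs} (R : Reply m L v zs) → let open Reply R in s ≡ y ⊎ s ∈ zs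
  reply-source {v} {zs} R = go (s ≟ y) (s ≟ x) (locate s zs)
    where
    open Reply R
    go : Dec (s ≡ y) → Dec (s ≡ x) → s ∈ zs ⊎ s ∉ zs → s ≡ y ⊎ s ∈ zs
    go (yes p) _ _ = inj₁ p
    go (no _) (yes p) _ = ⊥-elim (y∉ (subst (_∈ˢ L) (leaf (subst (_~ w) p s~w)) w∈))
    go (no _) (no _) (inj₁ i) = inj₂ i
    go (no ny) (no nx) (inj₂ o) = ⊥-elim (~⇒≢ s~w (only (full nx ny) o (inj₁ refl)))

  record ViaY (v a b : Fin n) : Set where
    field
      w    : Fin n
      w∈   : w ∈ˢ L
      w∉   : w ∉ v ∷ a ∷ b ∷ []
      y~w  : y ~ w
      only : ∀ {z} → z ∈ˢ L → y ~ z → z ∉ v ∷ a ∷ b ∷ [] → z ≡ w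
      rem  : Rest m L (w ∷ v ∷ a ∷ b ∷ [])

  record ViaNbr (v a b : Fin n) : Set where
    field
      w    : Fin n
      w∈   : w ∈ˢ L
      w∉   : w ∉ v ∷ a ∷ b ∷ []
      a~w  : a ~ w
      rem  : Rest m L (w ∷ v ∷ a ∷ b ∷ [])

  answers : ∀ {v a b} → Mid L v a b → ViaY v a b ⊎ ViaNbr v a b ⊎ ViaNbr v b a
  answers {v} {a} {b} M = go (reply-source R)
    where
    R = mid-reply M
    open Reply R
    go : s ≡ y ⊎ s ∈ v ∷ a ∷ b ∷ [] → ViaY v a b ⊎ ViaNbr v a b ⊎ ViaNbr v b a
    go (inj₁ p) = inj₁ (record
      { w = w ; w∈ = w∈ ; w∉ = w∉ ; y~w = subst (_~ w) p s~w
      ; only = λ {z} z∈ e o → only z∈ o (inj₂ (subst (_~ z) (sym p) e)) ; rem = rem })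
    -- Dominator's own vertex `v` has no surviving neighbor, so it cannot be the reply.
    go (inj₂ (here p)) = ⊥-elim (free w∈ w∉ (inj₂ (subst (_~ w) p s~w)))
    go (inj₂ (there (here p))) = inj₂ (inj₁ (record
      { w = w ; w∈ = w∈ ; w∉ = w∉ ; a~w = subst (_~ w) p s~w ; rem = rem }))
    go (inj₂ (there (there (here p)))) = inj₂ (inj₂ (record
      { w = w ; w∈ = w∈ ; w∉ = sw w∉ ; a~w = subst (_~ w) p s~w
      ; rem = relist (λ { (p ∷ ps) → p ∷ sw ps }) (λ { (p ∷ ps) → p ∷ sw ps }) rem }))
      where
      sw : ∀ {p q r z : Fin n} → z ∉ p ∷ q ∷ r ∷ [] → z ∉ p ∷ r ∷ q ∷ []
      sw (α ∷ β ∷ γ ∷ []) = α ∷ γ ∷ β ∷ []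

  -- Dominator plays `c 2`. The only vertex that a reply by `c 1` can remove is `c 0`, and for `c 3`
  -- it is `c 4`.
  chain-answers : (C : Chain) → let open Chain C in ViaY (c 2) (c 1) (c 3) ⊎ Block C ⊎ Block (drop 1 C)
  chain-answers C = go (answers (md 1))
    where
    open Chain C
    go : ViaY (c 2) (c 1) (c 3) ⊎ ViaNbr (c 2) (c 1) (c 3) ⊎ ViaNbr (c 2) (c 3) (c 1) →
      ViaY (c 2) (c 1) (c 3) ⊎ Block C ⊎ Block (drop 1 C)
    go (inj₁ r) = inj₁ r
    go (inj₂ (inj₁ r)) with nbr (md 0) (ViaNbr.w∈ r) (ViaNbr.a~w r) | ViaNbr.w∉ r
    ... | inj₂ q | o ∷ _ = ⊥-elim (o q)
    ... | inj₁ q | _ = inj₂ (inj₁ (subst (λ w → Rest m L (w ∷ c 1 ∷ c 2 ∷ c 3 ∷ [])) q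
      (relist (λ { (α ∷ β ∷ γ ∷ δ ∷ []) → α ∷ γ ∷ β ∷ δ ∷ [] }) (λ { (α ∷ β ∷ γ ∷ δ ∷ []) → α ∷ γ ∷ β ∷ δ ∷ [] }) (ViaNbr.rem r))))
    go (inj₂ (inj₂ r)) with nbr (md 2) (ViaNbr.w∈ r) (ViaNbr.a~w r) | ViaNbr.w∉ r
    ... | inj₁ q | o ∷ _ = ⊥-elim (o q)
    ... | inj₂ q | _ = inj₂ (inj₂ (subst (λ w → Rest m L (c 1 ∷ c 2 ∷ c 3 ∷ w ∷ [])) q
      (relist (λ { (α ∷ β ∷ γ ∷ δ ∷ []) → δ ∷ β ∷ γ ∷ α ∷ [] }) (λ { (α ∷ β ∷ γ ∷ δ ∷ []) → δ ∷ β ∷ γ ∷ α ∷ [] }) (ViaNbr.rem r))))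

  -- Long cycles

  record SomeRing : Set where
    constructor some-ring
    field
      {size} : ℕ
      period : Period size
      C      : Chain
      per    : Per (suc size) C

  block-ring : (C : Chain) → Block C → SomeRing
  block-ring C B = [ some-ring six C , some-ring seven C ]′ (block-period C B)

  -- If every answer came from y, then y would have a second neighbor w besides u = c 4, and w would be
  -- within distance one of both c 2 and c 6, hence at distance two from u or, on a hexagon, opposite to it.
  find-ring : (C : Chain) → y ~ Chain.c C 4 → SomeRing
  find-ring C y~u = go (chain-answers (drop 2 C)) (chain-answers C) (chain-answers (drop 4 C))
    where
    open Chain C
    -- `y` as a reply removes a single survivor, and here this is `c 4`; any other live neighbor of
    -- `y` was therefore removed by Dominator.
    near : ∀ {v a b} → ViaY v a b → c 4 ∉ v ∷ a ∷ b ∷ [] → ∀ {w} → w ∈ˢ L → y ~ w → w ≢ c 4 → w ∈ v ∷ a ∷ b ∷ []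
    near {v} {a} {b} r o {w} w∈ e ne with locate w (v ∷ a ∷ b ∷ [])
    ... | inj₁ i = i
    ... | inj₂ o′ = ⊥-elim (ne (trans (ViaY.only r w∈ e o′) (sym (ViaY.only r (c∈ 4) y~u o))))
    meet : ∀ {w} → w ∉ c 4 ∷ c 3 ∷ c 5 ∷ [] → w ∈ c 2 ∷ c 1 ∷ c 3 ∷ [] → w ∈ c 6 ∷ c 5 ∷ c 7 ∷ [] → SomeRing
    meet (_ ∷ o ∷ _) (there (there (here p))) _ = ⊥-elim (o p)
    meet (_ ∷ _ ∷ o ∷ []) _ (there (here p)) = ⊥-elim (o p)
    meet _ (here p) (here q) = ⊥-elim (n₄ 2 (trans (sym p) q))
    meet _ (here p) (there (there (here q))) = some-ring five (drop 2 C) (trans (sym q) p)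
    meet _ (there (here p)) (here q) = some-ring five (drop 1 C) (trans (sym q) p)
    meet _ (there (here p)) (there (there (here q))) = some-ring six (drop 1 C) (trans (sym q) p)
    go : ViaY (c 4) (c 3) (c 5) ⊎ Block (drop 2 C) ⊎ Block (drop 3 C) →
      ViaY (c 2) (c 1) (c 3) ⊎ Block C ⊎ Block (drop 1 C) →
      ViaY (c 6) (c 5) (c 7) ⊎ Block (drop 4 C) ⊎ Block (drop 5 C) → SomeRing
    go (inj₂ (inj₁ B)) _ _ = block-ring (drop 2 C) B
    go (inj₂ (inj₂ B)) _ _ = block-ring (drop 3 C) B
    go _ (inj₂ (inj₁ B)) _ = block-ring C B
    go _ (inj₂ (inj₂ B)) _ = block-ring (drop 1 C) B
    go _ _ (inj₂ (inj₁ B)) = block-ring (drop 4 C) B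
    go _ _ (inj₂ (inj₂ B)) = block-ring (drop 5 C) B
    go (inj₁ r) (inj₁ r₂) (inj₁ r₆) = meet w∉
      (near r₂ (≢-sym (n₂ 2) ∷ ≢-sym (n₃ 1) ∷ ≢-sym (n₁ 3) ∷ []) w∈ y~w (head w∉))
      (near r₆ (n₂ 4 ∷ n₁ 4 ∷ n₃ 4 ∷ []) w∈ y~w (head w∉))
      where
      open ViaY r
      head : ∀ {z a as} → z ∉ a ∷ as → z ≢ a
      head (p ∷ _) = p

  -- No live vertices outside a long cycle

  module Outside {k : ℕ} (P : Period k) (C : Chain) (per : Per (suc k) C) (y~u : y ~ Chain.c C 0)
    (u′ : Fin n) (u′∈ : u′ ∈ˢ L) (y~u′ : y ~ u′) where
    open Chain C
    open Ring P C per

    module _ (off : ¬ OnC u′) where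

      off-nbr : ∀ {z z′} → ¬ OnC z → z ∈ˢ L → z ~ z′ → ¬ OnC z′
      off-nbr o z∈ e i = o (onC-nbr i z∈ (~-sym e))

      on≢off : ∀ {z} i → ¬ OnC z → c i ≢ z
      on≢off i o refl = o (i , refl)

      -- A reply by `a` or `b` extends the path. A reply by `y` would have to remove its neighbor
      -- `c 0`, and the ring cut open there is a pendant path in a tight remainder.
      off-mid : ∀ {v a b} → Mid L v a b → ¬ OnC v → LongAt v
      off-mid {v} {a} {b} M ov = go (answers M)
        where
        oa = off-nbr ov (Mid.v∈ M) (Mid.v~a M)
        ob = off-nbr ov (Mid.v∈ M) (Mid.v~b M)
        go : ViaY v a b ⊎ ViaNbr v a b ⊎ ViaNbr v b a → LongAt v
        go (inj₂ (inj₁ r)) = extend-mid M (ViaNbr.w∈ r) (ViaNbr.a~w r) (ViaNbr.w∉ r)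
        go (inj₂ (inj₂ r)) = extend-mid (swap-mid M) (ViaNbr.w∈ r) (ViaNbr.a~w r) (ViaNbr.w∉ r)
        go (inj₁ r) = ⊥-elim (pendant-path still (in-rest 1 (≢-sym (n₁ 0))) (in-rest 2 (≢-sym (n₂ 0)))
            (in-rest 3 (≢-sym (n₃ 0))) (in-rest 4 (≢-sym (n₄ 0)))
            end (e 2) (e 3) (n₁ 1) (n₂ 1) (n₃ 1) (n₂ 2))
          where
          open ViaY r
          open Rest rem
          u≡w : c 0 ≡ w
          u≡w = only (c∈ 0) y~u (on≢off 0 ov ∷ on≢off 0 oa ∷ on≢off 0 ob ∷ [])
          in-rest : ∀ i → c i ≢ c 0 → c i ∈ˢ rest
          in-rest i ne = ⇒rest (c∈ i) ((λ q → ne (trans q (sym u≡w))) ∷ on≢off i ov ∷ on≢off i oa ∷ on≢off i ob ∷ [])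
          end : ∀ {z} → z ∈ˢ rest → c 1 ~ z → z ≡ c 2
          end z∈ f with nbr (md 0) (rest⇒∈ z∈) f
          ... | inj₂ q = q
          ... | inj₁ q with ne ∷ _ ← rest⇒∉ z∈ = ⊥-elim (ne (trans q u≡w))

      -- An edge forming a component of its own would allow Dominator to play y.
      no-edge-component : ∀ {v} → v ∈ˢ L → u′ ~ v → (∀ {z} → z ∈ˢ L → u′ ~ z → z ≡ v) → (∀ {z} → z ∈ˢ L → v ~ z → z ≡ u′) → ⊥
      no-edge-component {v} v∈ e′ only-v only-u = go (reply-source R)
        where
        off-v = off-nbr off u′∈ e′
        R = reply u′ v (c 0) (uniq3 (~⇒≢ e′) (≢-sym (on≢off 0 off)) (≢-sym (on≢off 0 off-v)))
          (dom-killed u′∈ (inj₂ y~u′) ∷ isolated-killed v∈ (λ z∈ f → inj₂ (subst (y ~_) (sym (only-u z∈ f)) y~u′))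
            ∷ dom-killed (c∈ 0) (inj₂ y~u) ∷ [])
          (u′ , u′∈ , inj₂ y~u′)
        open Reply R
        go : s ≡ y ⊎ s ∈ u′ ∷ v ∷ c 0 ∷ [] → ⊥
        go (inj₁ p) = free w∈ w∉ (inj₂ (subst (_~ w) p s~w))
        go (inj₂ (here p)) with _ ∷ o ∷ _ ← w∉ = o (only-v w∈ (subst (_~ w) p s~w))
        go (inj₂ (there (here p))) with o ∷ _ ← w∉ = o (only-u w∈ (subst (_~ w) p s~w))
        -- Both ring neighbors of `c 0` survive, so as a reply it would remove two vertices.
        go (inj₂ (there (there (here p)))) = Mid.a≢b M
          (trans (hit (k + 0) (Mid.a∈ M) (Mid.v~a M)) (sym (hit 1 (Mid.b∈ M) (Mid.v~b M))))
          where
          M = ring-mid 0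
          hit : ∀ i → c i ∈ˢ L → c 0 ~ c i → c i ≡ w
          hit i i∈ f = only i∈ (on≢off i off ∷ on≢off i off-v ∷ ≢-sym (~⇒≢ f) ∷ []) (inj₂ (subst (_~ c i) (sym p) f))

      off-long : LongAt u′
      off-long with Tight.closed t u′∈
      ... | v , v∈ , e′ with any? (λ z → (L z Bool.≟ true) ×-dec (adj G u′ z Bool.≟ true) ×-dec ¬? (z ≟ v))
      ...   | yes (z , z∈ , f , ne) = off-mid (mid u′∈ v∈ z∈ e′ f (≢-sym ne)) off
      ...   | no a with any? (λ z → (L z Bool.≟ true) ×-dec (adj G v z Bool.≟ true) ×-dec ¬? (z ≟ u′))
      ...     | yes (z , z∈ , f , ne) = longAt-nbr (off-mid (mid v∈ u′∈ z∈ (~-sym e′) f (≢-sym ne)) (off-nbr off u′∈ e′)) u′∈ (~-sym e′)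
      ...     | no b = ⊥-elim (no-edge-component v∈ e′ (sole a) (sole b))
        where
        sole : ∀ {p q} → ¬ (Σ (Fin n) λ z → z ∈ˢ L × p ~ z × z ≢ q) → ∀ {z} → z ∈ˢ L → p ~ z → z ≡ q
        sole {p} {q} h {z} z∈ f with z ≟ q
        ... | yes r = r
        ... | no ne = ⊥-elim (h (z , z∈ , f , ne))

      module Second (D : Chain) (D₂ : Chain.c D 2 ≡ u′) where
        open Chain D using () renaming (c to d; md to mdᵈ; c∈ to d∈; e to eᵈ; n₁ to n₁ᵈ; n₂ to n₂ᵈ; n₃ to n₃ᵈ; n₄ to n₄ᵈ)

        off-d : ∀ i → ¬ OnC (d (2 + i))
        off-d zero    = subst (λ z → ¬ OnC z) (sym D₂) off
        off-d (suc i) = off-nbr (off-d i) (d∈ (2 + i)) (eᵈ (2 + i))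

        off-d₁ : ¬ OnC (d 1)
        off-d₁ = off-nbr (off-d 0) (d∈ 2) (~-sym (eᵈ 1))

        -- `M` stands for what is left after four ring vertices are gone: off the ring nothing has
        -- changed. Tightness of `M` is used for a second pair of moves.
        module Left {m′ : ℕ} {M : Subset n} (still : Tight m′ M) (rest⇒∈ : ∀ {z} → z ∈ˢ M → z ∈ˢ L)
          (off⇒rest : ∀ {z} → z ∈ˢ L → ¬ OnC z → z ∈ˢ M) where

          -- Both survivors of the ring are removed by y, so no ring vertex is left for a reply.
          no-pair : ∀ {f} → c 0 ∈ˢ M → f ∈ˢ M → OnC f → c 0 ≢ f → (∀ {z} → z ∈ˢ M → OnC z → z ∈ c 0 ∷ f ∷ []) → ⊥
          no-pair {f} c₀∈ f∈ fon ne two = run m′ still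
            where
            Z = c 0 ∷ f ∷ u′ ∷ []
            u′∈′ = off⇒rest u′∈ off
            uniq : Unique Z
            uniq = uniq3 ne (on≢off 0 off) (λ { refl → off fon })
            run : ∀ m → Tight m M → ⊥
            run 0 s = case tight-lower s _ uniq (c₀∈ ∷ f∈ ∷ u′∈′ ∷ []) of λ ()
            run 1 s = case tight-lower s _ uniq (c₀∈ ∷ f∈ ∷ u′∈′ ∷ []) of λ { (s≤s (s≤s ())) }
            run (suc (suc m)) st = go (s ≟ y) (s ≟ x) (onC? s) (s ≟ u′)
              where
              R = Tight₂.reply st (c 0) f u′ uniq
                (dom-killed c₀∈ (inj₂ y~u) ∷ isolated-killed f∈ (λ z∈ g → inj₂ (via z∈ g)) ∷ dom-killed u′∈′ (inj₂ y~u′) ∷ [])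
                (c 0 , c₀∈ , inj₂ y~u)
                where
                via : ∀ {z} → z ∈ˢ M → f ~ z → y ~ z
                via z∈ g with two z∈ (onC-nbr fon (rest⇒∈ z∈) g)
                ... | here refl = y~u
                ... | there (here refl) = ⊥-elim (~-irr g)
              open Reply R
              off-w : ¬ OnC w
              off-w on with two w∈ on | w∉
              ... | here q         | o ∷ _     = o q
              ... | there (here q) | _ ∷ o ∷ _ = o q
              hit : ∀ z → z ∈ˢ L → ¬ OnC z → u′ ~ z → s ≡ u′ → z ≡ w
              hit z z∈ oz g p = only (off⇒rest z∈ oz)
                (≢-sym (on≢off 0 oz) ∷ (λ { refl → oz fon }) ∷ ≢-sym (~⇒≢ g) ∷ []) (inj₂ (subst (_~ z) (sym p) g))
              go : Dec (s ≡ y) → Dec (s ≡ x) → Dec (OnC s) → Dec (s ≡ u′) → ⊥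
              go (yes p) _ _ _ = free w∈ w∉ (inj₂ (subst (_~ w) p s~w))
              go _ (yes p) _ _ = y∉ (subst (_∈ˢ L) (leaf (subst (_~ w) p s~w)) (rest⇒∈ w∈))
              go _ _ (yes on) _ = off-w (onC-nbr on (rest⇒∈ w∈) s~w)
              -- As a reply, `u′` would remove both of its neighbors on the other long cycle, `d 1`
              -- and `d 3`.
              go _ _ _ (yes p) = n₂ᵈ 1 (trans
                (hit (d 1) (d∈ 1) off-d₁ (subst (_~ d 1) D₂ (~-sym (eᵈ 1))) p)
                (sym (hit (d 3) (d∈ 3) (off-d 1) (subst (_~ d 3) D₂ (eᵈ 2)) p)))
              go (no ny) (no nx) (no os) (no nu) = ~⇒≢ s~w (only (off⇒rest (full nx ny) os)
                ((λ q → os (0 , q)) ∷ (λ { q → os (subst OnC (sym q) fon) }) ∷ nu ∷ []) (inj₁ refl))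

          -- Dominator plays the center of the surviving path; only y can reply, which cuts open the other ring.
          no-triple : ∀ {v a b} → Mid M v a b → OnC v → OnC a → OnC b →
            (∀ {z} → z ∈ˢ M → OnC z → z ∈ v ∷ a ∷ b ∷ []) → ⊥
          no-triple {v} {a} {b} mid′ vo ao bo three = run m′ still
            where
            Z = v ∷ a ∷ b ∷ []
            offZ : ∀ {z} → ¬ OnC z → z ∉ Z
            offZ oz = (λ { refl → oz vo }) ∷ (λ { refl → oz ao }) ∷ (λ { refl → oz bo }) ∷ []
            v∈ab = Mid.v∈ mid′ ∷ Mid.a∈ mid′ ∷ Mid.b∈ mid′ ∷ []
            run : ∀ m → Tight m M → ⊥
            run 0 s = case tight-lower s _ (mid-uniq mid′) v∈ab of λ ()
            run 1 s = case tight-lower s _ (mid-uniq mid′) v∈ab of λ { (s≤s (s≤s ())) }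
            run (suc (suc m)) st = go (s ≟ y) (s ≟ x) (onC? s)
              where
              R = Tight₂.mid-reply st mid′
              open Reply R
              go : Dec (s ≡ y) → Dec (s ≡ x) → Dec (OnC s) → ⊥
              go _ (yes p) _ = y∉ (subst (_∈ˢ L) (leaf (subst (_~ w) p s~w)) (rest⇒∈ w∈))
              go _ _ (yes on) = All.lookup w∉ (three w∈ (onC-nbr on (rest⇒∈ w∈) s~w)) refl
              go (no ny) (no nx) (no os) = ~⇒≢ s~w (only (off⇒rest (full nx ny) os) (offZ os) (inj₁ refl))
              go (yes p) _ _ = pendant-path (Rest.still rem) (in-rest 1 (≢-sym (n₁ᵈ 2))) (in-rest 2 (≢-sym (n₂ᵈ 2)))
                  (in-rest 3 (≢-sym (n₃ᵈ 2))) (in-rest 4 (≢-sym (n₄ᵈ 2))) end (eᵈ 4) (eᵈ 5) (n₁ᵈ 3) (n₂ᵈ 3) (n₃ᵈ 3) (n₂ᵈ 4)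
                where
                u≡w : d 2 ≡ w
                u≡w = trans D₂ (only (off⇒rest u′∈ off) (offZ off) (inj₂ (subst (_~ u′) (sym p) y~u′)))
                in-rest : ∀ i → d (2 + i) ≢ d 2 → d (2 + i) ∈ˢ Rest.rest rem
                in-rest i ne = Rest.⇒rest rem (off⇒rest (d∈ (2 + i)) (off-d i)) ((λ q → ne (trans q (sym u≡w))) ∷ offZ (off-d i))
                end : ∀ {z} → z ∈ˢ Rest.rest rem → d 3 ~ z → z ≡ d 4
                end z∈ f with nbr (mdᵈ 2) (rest⇒∈ (Rest.rest⇒∈ rem z∈)) f
                ... | inj₂ q = q
                ... | inj₁ q with ne ∷ _ ← Rest.rest⇒∉ rem z∈ = ⊥-elim (ne (trans q u≡w))

      block-off : ∀ j (B : Block (drop j C)) → ∀ {z} → z ∈ˢ L → ¬ OnC z → z ∈ˢ Rest.rest B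
      block-off j B z∈ oz = Rest.⇒rest B z∈ (≢-sym (on≢off j oz) ∷ ≢-sym (on≢off (1 + j) oz) ∷
        ≢-sym (on≢off (2 + j) oz) ∷ ≢-sym (on≢off (3 + j) oz) ∷ [])

  -- Dominator plays `c 3`, since `c 2`, `c 3`, `c 4` avoid `c 0` for each length: a reply by `y`
  -- would then have to remove both `c 0` and `u′`. The other replies delete `c 1` to `c 4` or `c 2`
  -- to `c 5`; this is impossible for length five and leaves two ring vertices for length six, three
  -- for length seven.
  no-outside : ∀ {k} (P : Period k) (C : Chain) (per : Per (suc k) C) → y ~ Chain.c C 0 →
    ∀ {u′} → u′ ∈ˢ L → y ~ u′ → ¬ Ring.OnC P C per u′ → ⊥
  no-outside P C per y~u {u′} u′∈ y~u′ off with Outside.off-long P C per y~u u′ u′∈ y~u′ off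
  ... | p , p₂ = go P per off (chain-answers (drop 1 C))
    where
    open Chain C
    D = proj₁ (chain p)
    D₂ : Chain.c D 2 ≡ u′
    D₂ = trans (proj₂ (chain p)) p₂

    module _ {k} (P : Period k) (per : Per (suc k) C) (off : ¬ Ring.OnC P C per u′) where
      open Ring P C per
      open Outside P C per y~u u′ u′∈ y~u′

      pair : ∀ j (B : Block (drop j C)) → let open Rest B in ∀ {f} → c 0 ∈ˢ rest → f ∈ˢ rest → OnC f → c 0 ≢ f →
        (∀ {z} → z ∈ˢ rest → z ∈ ring → z ∈ c 0 ∷ f ∷ []) → ⊥
      pair j B i₀ i ofⁿ ne two = Second.Left.no-pair off D D₂ (Rest.still B) (Rest.rest⇒∈ B) (block-off off j B)
        i₀ i ofⁿ ne (λ z∈ → two z∈ ∘ onC⇒ring)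

      triple : ∀ j (B : Block (drop j C)) → let open Rest B in ∀ {v a b} → Mid L v a b →
        v ∈ˢ rest → a ∈ˢ rest → b ∈ˢ rest → OnC v → OnC a → OnC b →
        (∀ {z} → z ∈ˢ rest → z ∈ ring → z ∈ v ∷ a ∷ b ∷ []) → ⊥
      triple j B M i₁ i₂ i₃ vo ao bo three = Second.Left.no-triple off D D₂ (Rest.still B) (Rest.rest⇒∈ B) (block-off off j B)
        (mid i₁ i₂ i₃ (Mid.v~a M) (Mid.v~b M) (Mid.a≢b M)) vo ao bo (λ z∈ → three z∈ ∘ onC⇒ring)

    go : ∀ {k} (P : Period k) (per : Per (suc k) C) → ¬ Ring.OnC P C per u′ →
      ViaY (c 3) (c 2) (c 4) ⊎ Block (drop 1 C) ⊎ Block (drop 2 C) → ⊥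
    go P per off (inj₁ r) = off (0 , trans (ViaY.only r u′∈ y~u′ (o 3 ∷ o 2 ∷ o 4 ∷ []))
      (sym (ViaY.only r (c∈ 0) y~u (n₃ 0 ∷ n₂ 0 ∷ n₄ 0 ∷ []))))
      where
      o : ∀ i → u′ ≢ c i
      o i q = off (i , q)
    go five per off (inj₂ (inj₁ B)) with block-period (drop 1 C) B
    ... | inj₁ q = n₁ 1 (trans (sym q) (Ring.periodic five C per 2))
    ... | inj₂ q = n₂ 1 (trans (sym q) (Ring.periodic five C per 3))
    go five per off (inj₂ (inj₂ B)) with block-period (drop 2 C) B
    ... | inj₁ q = n₁ 2 (trans (sym q) (Ring.periodic five C per 3))
    ... | inj₂ q = n₂ 2 (trans (sym q) (Ring.periodic five C per 4))
    go six per off (inj₂ (inj₁ B)) = pair six per off 1 B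
      (⇒rest (c∈ 0) (n₁ 0 ∷ n₂ 0 ∷ n₃ 0 ∷ n₄ 0 ∷ []))
      (⇒rest (c∈ 5) (≢-sym (n₄ 1) ∷ ≢-sym (n₃ 2) ∷ ≢-sym (n₂ 3) ∷ ≢-sym (n₁ 4) ∷ []))
      (5 , refl) (λ q → n₁ 5 (trans (sym q) (sym per))) two
      where
      open Rest B
      two : ∀ {z} → z ∈ˢ rest → z ∈ Ring.ring six C per → z ∈ c 0 ∷ c 5 ∷ []
      two z∈ (here q) = here q
      two z∈ (there (there (there (there (there (here q)))))) = there (here q)
      two z∈ (there (here q)) with o ∷ _ ← rest⇒∉ z∈ = ⊥-elim (o q)
      two z∈ (there (there (here q))) with _ ∷ o ∷ _ ← rest⇒∉ z∈ = ⊥-elim (o q)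
      two z∈ (there (there (there (here q)))) with _ ∷ _ ∷ o ∷ _ ← rest⇒∉ z∈ = ⊥-elim (o q)
      two z∈ (there (there (there (there (here q))))) with _ ∷ _ ∷ _ ∷ o ∷ _ ← rest⇒∉ z∈ = ⊥-elim (o q)
    go six per off (inj₂ (inj₂ B)) = pair six per off 2 B
      (⇒rest (c∈ 0) (n₂ 0 ∷ n₃ 0 ∷ n₄ 0 ∷ (λ q → n₁ 5 (trans (sym q) (sym per))) ∷ []))
      (⇒rest (c∈ 1) (n₁ 1 ∷ n₂ 1 ∷ n₃ 1 ∷ n₄ 1 ∷ []))
      (1 , refl) (n₁ 0) two
      where
      open Rest B
      two : ∀ {z} → z ∈ˢ rest → z ∈ Ring.ring six C per → z ∈ c 0 ∷ c 1 ∷ []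
      two z∈ (here q) = here q
      two z∈ (there (here q)) = there (here q)
      two z∈ (there (there (here q))) with o ∷ _ ← rest⇒∉ z∈ = ⊥-elim (o q)
      two z∈ (there (there (there (here q)))) with _ ∷ o ∷ _ ← rest⇒∉ z∈ = ⊥-elim (o q)
      two z∈ (there (there (there (there (here q))))) with _ ∷ _ ∷ o ∷ _ ← rest⇒∉ z∈ = ⊥-elim (o q)
      two z∈ (there (there (there (there (there (here q)))))) with _ ∷ _ ∷ _ ∷ o ∷ _ ← rest⇒∉ z∈ = ⊥-elim (o q)
    go seven per off (inj₂ (inj₁ B)) = triple seven per off 1 B (subst (Mid L (c 6) (c 5)) per (md 5))
      (⇒rest (c∈ 6) ((λ q → n₂ 6 (trans q (sym (Ring.periodic seven C per 1)))) ∷ ≢-sym (n₄ 2) ∷ ≢-sym (n₃ 3) ∷ ≢-sym (n₂ 4) ∷ []))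
      (⇒rest (c∈ 5) (≢-sym (n₄ 1) ∷ ≢-sym (n₃ 2) ∷ ≢-sym (n₂ 3) ∷ ≢-sym (n₁ 4) ∷ []))
      (⇒rest (c∈ 0) (n₁ 0 ∷ n₂ 0 ∷ n₃ 0 ∷ n₄ 0 ∷ []))
      (6 , refl) (5 , refl) (0 , refl) three
      where
      open Rest B
      three : ∀ {z} → z ∈ˢ rest → z ∈ Ring.ring seven C per → z ∈ c 6 ∷ c 5 ∷ c 0 ∷ []
      three z∈ (here q) = there (there (here q))
      three z∈ (there (there (there (there (there (here q)))))) = there (here q)
      three z∈ (there (there (there (there (there (there (here q))))))) = here q
      three z∈ (there (here q)) with o ∷ _ ← rest⇒∉ z∈ = ⊥-elim (o q)
      three z∈ (there (there (here q))) with _ ∷ o ∷ _ ← rest⇒∉ z∈ = ⊥-elim (o q)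
      three z∈ (there (there (there (here q)))) with _ ∷ _ ∷ o ∷ _ ← rest⇒∉ z∈ = ⊥-elim (o q)
      three z∈ (there (there (there (there (here q))))) with _ ∷ _ ∷ _ ∷ o ∷ _ ← rest⇒∉ z∈ = ⊥-elim (o q)
    go seven per off (inj₂ (inj₂ B)) = triple seven per off 2 B (Ring.ring-mid seven C per 0)
      (⇒rest (c∈ 0) (n₂ 0 ∷ n₃ 0 ∷ n₄ 0 ∷ (λ q → n₂ 5 (trans (sym q) (sym per))) ∷ []))
      (⇒rest (c∈ 6) (≢-sym (n₄ 2) ∷ ≢-sym (n₃ 3) ∷ ≢-sym (n₂ 4) ∷ ≢-sym (n₁ 5) ∷ []))
      (⇒rest (c∈ 1) (n₁ 1 ∷ n₂ 1 ∷ n₃ 1 ∷ n₄ 1 ∷ []))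
      (0 , refl) (6 , refl) (1 , refl) three
      where
      open Rest B
      three : ∀ {z} → z ∈ˢ rest → z ∈ Ring.ring seven C per → z ∈ c 0 ∷ c 6 ∷ c 1 ∷ []
      three z∈ (here q) = here q
      three z∈ (there (here q)) = there (there (here q))
      three z∈ (there (there (there (there (there (there (here q))))))) = there (here q)
      three z∈ (there (there (here q))) with o ∷ _ ← rest⇒∉ z∈ = ⊥-elim (o q)
      three z∈ (there (there (there (here q)))) with _ ∷ o ∷ _ ← rest⇒∉ z∈ = ⊥-elim (o q)
      three z∈ (there (there (there (there (here q))))) with _ ∷ _ ∷ o ∷ _ ← rest⇒∉ z∈ = ⊥-elim (o q)
      three z∈ (there (there (there (there (there (here q)))))) with _ ∷ _ ∷ _ ∷ o ∷ _ ← rest⇒∉ z∈ = ⊥-elim (o q)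

  record Hexagon : Set where
    field
      C     : Chain
      per   : Per 6 C
      y~c₀  : y ~ Chain.c C 0
      cover : ∀ {z} → z ∈ˢ L → z ∈ Ring.ring six C per

  ring-hexagon : SomeRing → Hexagon
  ring-hexagon (some-ring P C₀ per₀) with escape (Ring.OnC P C₀ per₀) (λ o _ w∈ e → Ring.onC-nbr P C₀ per₀ o w∈ e) (0 , refl) (Chain.c∈ C₀ 0)
  ... | _ , (i , refl) , _ , y~u = go P (Ring.periodic P C₀ per₀ i)
    where
    C = drop i C₀
    open Chain C
    covered : ∀ {k} (P : Period k) (per : Per (suc k) C) → ∀ {z} → z ∈ˢ L → z ∈ Ring.ring P C per
    covered P per {z} z∈ with Ring.onC? P C per z
    ... | yes o = Ring.onC⇒ring P C per o
    ... | no o with u′ , o′ , u′∈ , y~u′ ← escape (λ z → ¬ Ring.OnC P C per z)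
                      (λ o z∈ _ e q → o (Ring.onC-nbr P C per q z∈ (~-sym e))) o z∈ =
      ⊥-elim (no-outside P C per y~u u′∈ y~u′ o′)
    -- The live vertices number `2 * (2 + m)`, so a ring of odd length cannot contain all of them.
    even-card : ∀ {q} zs → length zs ≡ suc (2 * q) → Unique zs → All (_∈ˢ L) zs → (∀ {z} → z ∈ˢ L → z ∈ zs) → ⊥
    even-card {q} zs l u as cov = even≢odd (2 + m) q (trans (sym (tight-card t)) (trans (≤-antisym (countF-upper L zs (λ _ → cov)) (countF-lower L zs u as)) l))
    go : ∀ {k} (P : Period k) (per : Per (suc k) C) → Hexagon
    go six per = record { C = C ; per = per ; y~c₀ = y~u ; cover = covered six per }
    go five per = ⊥-elim (even-card {2} (Ring.ring five C per) refl
      ((n₁ 0 ∷ n₂ 0 ∷ n₃ 0 ∷ n₄ 0 ∷ []) ∷ uniq4 (n₁ 1) (n₂ 1) (n₃ 1) (n₁ 2) (n₂ 2) (n₁ 3))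
      (c∈ 0 ∷ c∈ 1 ∷ c∈ 2 ∷ c∈ 3 ∷ c∈ 4 ∷ []) (covered five per))
    go seven per = ⊥-elim (even-card {3} (Ring.ring seven C per) refl
      ((n₁ 0 ∷ n₂ 0 ∷ n₃ 0 ∷ n₄ 0 ∷ (λ q → n₂ 5 (trans (sym q) (sym per))) ∷ (λ q → n₁ 6 (trans (sym q) (sym per))) ∷ []) ∷
       (n₁ 1 ∷ n₂ 1 ∷ n₃ 1 ∷ n₄ 1 ∷ (λ q → n₂ 6 (trans (sym q) (sym (Ring.periodic seven C per 1)))) ∷ []) ∷
       (n₁ 2 ∷ n₂ 2 ∷ n₃ 2 ∷ n₄ 2 ∷ []) ∷ uniq4 (n₁ 3) (n₂ 3) (n₃ 3) (n₁ 4) (n₂ 4) (n₁ 5))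
      (c∈ 0 ∷ c∈ 1 ∷ c∈ 2 ∷ c∈ 3 ∷ c∈ 4 ∷ c∈ 5 ∷ c∈ 6 ∷ []) (covered seven per))

  long-hexagon : ∀ {v} → LongAt v → v ∈ˢ L → Hexagon
  long-hexagon l v∈ with escape LongAt (λ l _ w∈ e → longAt-nbr l w∈ e) l v∈
  -- Two steps back place `u` at index 4 of the chain, where `find-ring` expects the neighbor of
  -- `y`.
  ... | u , (p , refl) , _ , y~u = ring-hexagon (find-ring (proj₁ (chain (back (back p)))) y~u)

  -- Two short components

  Short : Set
  Short = ∀ {v a b a₂} → Mid L v a b → a₂ ∈ˢ L → a ~ a₂ → a₂ ∈ v ∷ a ∷ b ∷ []

  record Pendant (Z : List (Fin n)) : Set where
    field
      w₀ w₁ w₂ : Fin n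
      path : Mid L w₁ w₀ w₂
      w₀∉  : w₀ ∉ Z
      y~w₀ : y ~ w₀
      only : ∀ {z} → z ∈ˢ L → y ~ z → z ∉ Z → z ≡ w₀

  -- A reply by `a` or `b` would remove a live neighbor outside the triple, against `Short`; so the
  -- reply is `y`, with `w₀` the vertex removed. A neighbor `w₁` of `w₀` survives in the tight
  -- remainder and so has a further neighbor `w₂` there.
  short-pendant : Short → ∀ {v a b} → Mid L v a b → Pendant (v ∷ a ∷ b ∷ [])
  short-pendant sh {v} {a} {b} M = go (answers M)
    where
    clash : ∀ {z zs} → z ∈ zs → z ∉ zs → ⊥
    clash i o = All.lookup o i refl
    go : ViaY v a b ⊎ ViaNbr v a b ⊎ ViaNbr v b a → Pendant (v ∷ a ∷ b ∷ [])
    go (inj₂ (inj₁ r)) = ⊥-elim (clash (sh M (ViaNbr.w∈ r) (ViaNbr.a~w r)) (ViaNbr.w∉ r))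
    go (inj₂ (inj₂ r)) = ⊥-elim (clash (sh (swap-mid M) (ViaNbr.w∈ r) (ViaNbr.a~w r)) (ViaNbr.w∉ r))
    go (inj₁ r) with keep M (ViaY.w∈ r) (ViaY.w∉ r)
    ... | w₁ , w₁∈ , e , o with w₂ , w₂∈ , f ← Tight.closed (Rest.still (ViaY.rem r)) (Rest.⇒rest (ViaY.rem r) w₁∈ (≢-sym (~⇒≢ e) ∷ o)) = record
      { w₀ = w ; w₁ = w₁ ; w₂ = w₂
      ; path = mid w₁∈ w∈ (Rest.rest⇒∈ rem w₂∈) (~-sym e) f (λ q → All.lookup (Rest.rest⇒∉ rem w₂∈) (here refl) (sym q))
      ; w₀∉ = w∉ ; y~w₀ = y~w ; only = only }
      where open ViaY r

  triple-closed : Short → ∀ {v a b} → Mid L v a b → ∀ {z z′} → z ∈ v ∷ a ∷ b ∷ [] → z′ ∈ˢ L → z ~ z′ → z′ ∈ v ∷ a ∷ b ∷ []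
  triple-closed sh M (here refl) z∈ e = [ (λ q → there (here q)) , (λ q → there (there (here q))) ]′ (nbr M z∈ e)
  triple-closed sh M (there (here refl)) z∈ e = sh M z∈ e
  triple-closed sh M (there (there (here refl))) z∈ e = sw (sh (swap-mid M) z∈ e)
    where
    sw : ∀ {p q r z : Fin n} → z ∈ p ∷ q ∷ r ∷ [] → z ∈ p ∷ r ∷ q ∷ []
    sw (here q) = here q
    sw (there (here q)) = there (there (here q))
    sw (there (there (here q))) = there (here q)

  record Twins : Set where
    field
      a₀ a₁ a₂ b₀ b₁ b₂ : Fin n
      A : Mid L a₁ a₀ a₂
      B : Mid L b₁ b₀ b₂
      y~a₀ : y ~ a₀
      y~b₀ : y ~ b₀
      y≁a₁ : ¬ y ~ a₁
      y≁a₂ : ¬ y ~ a₂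
      y≁b₁ : ¬ y ~ b₁
      y≁b₂ : ¬ y ~ b₂
      apart : ∀ {z z′} → z ∈ a₁ ∷ a₀ ∷ a₂ ∷ [] → z′ ∈ b₁ ∷ b₀ ∷ b₂ ∷ [] → ¬ z ~ z′
      cover : ∀ {z} → z ∈ˢ L → z ∈ a₁ ∷ a₀ ∷ a₂ ∷ [] ⊎ z ∈ b₁ ∷ b₀ ∷ b₂ ∷ []

  module _ (sh : Short) {v a b : Fin n} (M : Mid L v a b) (p : Pendant (v ∷ a ∷ b ∷ []))
    (q : Pendant (Pendant.w₁ p ∷ Pendant.w₀ p ∷ Pendant.w₂ p ∷ [])) where
    private
      module P = Pendant p
      module Q = Pendant q

    -- Two rounds are made because `M` comes without information on where it is attached to `y`.
    -- Outside `M` the only neighbor of `y` is the end of `p`, and outside the path of `p` it is the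
    -- end of `q`; a third component would contain one more neighbor of `y`.
    pendants-twins : Twins
    pendants-twins = record
      { a₀ = P.w₀ ; a₁ = P.w₁ ; a₂ = P.w₂ ; b₀ = Q.w₀ ; b₁ = Q.w₁ ; b₂ = Q.w₂ ; A = P.path ; B = Q.path
      ; y~a₀ = P.y~w₀ ; y~b₀ = Q.y~w₀
      ; y≁a₁ = λ e → ~⇒≢ (Mid.v~a P.path) (P.only (Mid.v∈ P.path) e (avoid P.path M (there (here refl)) P.w₀∉ (here refl)))
      ; y≁a₂ = λ e → Mid.a≢b P.path (sym (P.only (Mid.b∈ P.path) e (avoid P.path M (there (here refl)) P.w₀∉ (there (there (here refl))))))
      ; y≁b₁ = λ e → ~⇒≢ (Mid.v~a Q.path) (Q.only (Mid.v∈ Q.path) e (avoid Q.path P.path (there (here refl)) Q.w₀∉ (here refl)))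
      ; y≁b₂ = λ e → Mid.a≢b Q.path (sym (Q.only (Mid.b∈ Q.path) e (avoid Q.path P.path (there (here refl)) Q.w₀∉ (there (there (here refl))))))
      ; apart = λ i j e → clash (triple-closed sh P.path i (∈L Q.path j) e) (avoid Q.path P.path (there (here refl)) Q.w₀∉ j)
      ; cover = cover }
      where
      clash : ∀ {z zs} → z ∈ zs → z ∉ zs → ⊥
      clash i o = All.lookup o i refl
      ∈L : ∀ {v a b z} → Mid L v a b → z ∈ v ∷ a ∷ b ∷ [] → z ∈ˢ L
      ∈L M (here refl) = Mid.v∈ M
      ∈L M (there (here refl)) = Mid.a∈ M
      ∈L M (there (there (here refl))) = Mid.b∈ M
      center : ∀ {v a b v′ a′ b′ z} → Mid L v a b → Mid L v′ a′ b′ → z ∈ v ∷ a ∷ b ∷ [] → z ∈ v′ ∷ a′ ∷ b′ ∷ [] → v ∈ v′ ∷ a′ ∷ b′ ∷ []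
      center N N′ (here refl) j = j
      center N N′ (there (here refl)) j = triple-closed sh N′ j (Mid.v∈ N) (~-sym (Mid.v~a N))
      center N N′ (there (there (here refl))) j = triple-closed sh N′ j (Mid.v∈ N) (~-sym (Mid.v~b N))
      spread : ∀ {v a b v′ a′ b′ z} → Mid L v a b → Mid L v′ a′ b′ → v ∈ v′ ∷ a′ ∷ b′ ∷ [] → z ∈ v ∷ a ∷ b ∷ [] → z ∈ v′ ∷ a′ ∷ b′ ∷ []
      spread N N′ j (here refl) = j
      spread N N′ j (there (here refl)) = triple-closed sh N′ j (Mid.a∈ N) (Mid.v~a N)
      spread N N′ j (there (there (here refl))) = triple-closed sh N′ j (Mid.b∈ N) (Mid.v~b N)
      -- Triples are closed under live adjacency, so if two of them met, the first would lie inside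
      -- the second.
      avoid : ∀ {v a b v′ a′ b′ z z₀} → Mid L v a b → Mid L v′ a′ b′ → z₀ ∈ v ∷ a ∷ b ∷ [] → z₀ ∉ v′ ∷ a′ ∷ b′ ∷ [] →
        z ∈ v ∷ a ∷ b ∷ [] → z ∉ v′ ∷ a′ ∷ b′ ∷ []
      avoid {v′ = v′} {a′} {b′} {z} N N′ i₀ o i with locate z (v′ ∷ a′ ∷ b′ ∷ [])
      ... | inj₂ o′ = o′
      ... | inj₁ j = ⊥-elim (clash (spread N N′ (center N N′ i j) i₀) o)
      A = P.w₁ ∷ P.w₀ ∷ P.w₂ ∷ []
      B = Q.w₁ ∷ Q.w₀ ∷ Q.w₂ ∷ []
      out : ∀ {v a b z z′} → Mid L v a b → z ∉ v ∷ a ∷ b ∷ [] → z ∈ˢ L → z ~ z′ → z′ ∉ v ∷ a ∷ b ∷ []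
      out {v} {a} {b} {z′ = z′} N o z∈ e with locate z′ (v ∷ a ∷ b ∷ [])
      ... | inj₂ o′ = o′
      ... | inj₁ i = ⊥-elim (clash (triple-closed sh N i z∈ (~-sym e)) o)
      closed : ∀ {z z′} → z ∉ A × z ∉ B → z ∈ˢ L → z′ ∈ˢ L → z ~ z′ → z′ ∉ A × z′ ∉ B
      closed (o , o′) z∈ _ e = out P.path o z∈ e , out Q.path o′ z∈ e
      cover : ∀ {z} → z ∈ˢ L → z ∈ A ⊎ z ∈ B
      cover {z} z∈ with locate z A | locate z B
      ... | inj₁ i | _ = inj₁ i
      ... | _ | inj₁ j = inj₂ j
      ... | inj₂ o | inj₂ o′ with u , (k , k′) , u∈ , e ← escape (λ z → z ∉ A × z ∉ B) closed (o , o′) z∈ =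
        ⊥-elim (clash (subst (_∈ B) (sym (Q.only u∈ e k)) (there (here refl))) k′)

  short-twins : Short → HasMid L → Twins
  short-twins sh (_ , _ , _ , M) = pendants-twins sh M p (short-pendant sh (Pendant.path p))
    where
    p = short-pendant sh M

  -- A matching on the live vertices would have at least two edges, each with an end adjacent to
  -- `y`. Dominator playing `y` would remove four vertices, the other ends being dominated or
  -- isolated.
  has-mid : HasMid L
  has-mid with mid? L
  ... | yes h = h
  ... | no nm = ⊥-elim (go (Tight.closed t (proj₁ (proj₂ some))))
    where
    some : Σ (Fin n) λ z → z ∈ˢ L × y ~ z
    some with _ , z , z∈ , _ ← proj₁ (Tight.force t) with u , _ , u∈ , e ← escape (λ _ → Fin n) (λ _ _ _ _ → z) z z∈ = u , u∈ , e
    p = proj₁ some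
    mate : ∀ {z w w′} → z ∈ˢ L → w ∈ˢ L → w′ ∈ˢ L → z ~ w → z ~ w′ → w′ ≡ w
    mate {z} {w} {w′} z∈ w∈ w′∈ e f with w′ ≟ w
    ... | yes q = q
    ... | no ne = ⊥-elim (nm (z , w , w′ , mid z∈ w∈ w′∈ e f (≢-sym ne)))
    attached : ∀ {z w} → z ∈ˢ L → w ∈ˢ L → z ~ w → y ~ z → ∀ {v} → v ∈ z ∷ w ∷ [] → Killed L y v
    attached z∈ w∈ e f (here refl) = dom-killed z∈ (inj₂ f)
    attached z∈ w∈ e f (there (here refl)) = isolated-killed w∈ λ v∈ g → inj₂ (subst (y ~_) (sym (mate w∈ z∈ v∈ (~-sym e) g)) f)
    outside : ∀ {q} → q ∈ˢ L → p ~ q → ∀ {z z′} → z ≢ p × z ≢ q → z ∈ˢ L → z′ ∈ˢ L → z ~ z′ → z′ ≢ p × z′ ≢ q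
    outside q∈ pq (a , b) z∈ z′∈ e =
      (λ { refl → b (mate (proj₁ (proj₂ some)) q∈ z∈ pq (~-sym e)) }) ,
      (λ { refl → a (mate q∈ (proj₁ (proj₂ some)) z∈ (~-sym pq) (~-sym e)) })
    go : (Σ (Fin n) λ q → q ∈ˢ L × p ~ q) → ⊥
    go (q , q∈ , pq) with any? (λ z → (L z Bool.≟ true) ×-dec ¬? (z ≟ p) ×-dec ¬? (z ≟ q))
    ... | no none = 1+n≰n {2} (≤-trans (s≤s (s≤s (s≤s z≤n))) (≤-trans (≤-reflexive (sym (double-2+ m))) (≤-trans (≤-reflexive (sym (tight-card t)))
        (countF-upper L (p ∷ q ∷ []) inside))))
      where
      inside : ∀ z → z ∈ˢ L → z ∈ p ∷ q ∷ []
      inside z z∈ with z ≟ p | z ≟ q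
      ... | yes e | _ = here e
      ... | _ | yes e = there (here e)
      ... | no a | no b = ⊥-elim (none (z , z∈ , a , b))
    ... | yes (r , r∈ , rp , rq) with u , (up , uq) , u∈ , yu ← escape (λ z → z ≢ p × z ≢ q) (outside q∈ pq) (rp , rq) r∈
                                 with w , w∈ , uw ← Tight.closed t u∈ =
      no-four (u ∷ w ∷ p ∷ q ∷ []) refl
        (uniq4 (~⇒≢ uw) up uq
          (λ { refl → uq (mate p∈ q∈ u∈ pq (~-sym uw)) }) (λ { refl → up (mate q∈ p∈ u∈ (~-sym pq) (~-sym uw)) }) (~⇒≢ pq))
        (attached u∈ w∈ uw yu (here refl) ∷ attached u∈ w∈ uw yu (there (here refl)) ∷
         attached p∈ q∈ pq yp (here refl) ∷ attached p∈ q∈ pq yp (there (here refl)) ∷ [])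
        (u , u∈ , inj₂ yu)
      where
      p∈ = proj₁ (proj₂ some)
      yp = proj₂ (proj₂ some)

  structure : Hexagon ⊎ Twins
  structure with any? (λ v → any? λ a → any? λ b → any? λ z → mid-dec L v a b ×-dec (L z Bool.≟ true) ×-dec
                  (adj G a z Bool.≟ true) ×-dec ¬? (z ≟ v) ×-dec ¬? (z ≟ b))
  ... | yes (v , a , b , z , M , z∈ , e , nv , nb) = inj₁ (long-hexagon (extend-mid M z∈ e (nv ∷ ≢-sym (~⇒≢ e) ∷ nb ∷ [])) (Mid.v∈ M))
  ... | no none = inj₂ (short-twins short has-mid)
    where
    short : Short
    short {v} {a} {b} {z} M z∈ e with z ≟ v | z ≟ b
    ... | yes q | _ = here q
    ... | no _ | yes q = there (there (here q))
    ... | no nv | no nb = ⊥-elim (none (v , a , b , z , M , z∈ , e , nv , nb))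

-- Forcing is invariant under isomorphism

module Transfer {n k : ℕ} {G : Graph n} {H : Graph k} (φ : Isomorphic G H) where
  private
    module G = Play G
    module H = Play H
    to   = Inverse.to (proj₁ φ)
    from = Inverse.from (proj₁ φ)

    to-from : ∀ i → to (from i) ≡ i
    to-from i = Inverse.inverseˡ (proj₁ φ) refl

    from-to : ∀ z → from (to z) ≡ z
    from-to z = Inverse.inverseʳ (proj₁ φ) refl

    edge : ∀ {a b} → a G.~ b → to a H.~ to b
    edge {a} {b} = trans (proj₂ φ a b)

    edge⁻¹ : ∀ {a b} → to a H.~ to b → a G.~ b
    edge⁻¹ {a} {b} = trans (sym (proj₂ φ a b))

    dom : ∀ {v z} → G.Dom v z → H.Dom (to v) (to z)
    dom (inj₁ e) = inj₁ (cong to e)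
    dom (inj₂ e) = inj₂ (edge e)

    dom⁻¹ : ∀ {v z} → H.Dom (to v) (to z) → G.Dom v z
    dom⁻¹ (inj₁ e) = inj₁ (trans (sym (from-to _)) (trans (cong from e) (from-to _)))
    dom⁻¹ (inj₂ e) = inj₂ (edge⁻¹ e)

  record Same (L : Subset n) (M : Subset k) : Set where
    constructor same
    field
      at : ∀ z → L z ≡ M (to z)
  open Same

  private
    after-same : ∀ {L M} → Same L M → ∀ v → Same (G.after L v) (H.after M (to v))
    after-same {L} {M} h v = same λ z → truth-ext
      (λ p → case G.after⇒ p of λ { (G.survives l s w zw lw sw) →
        H.⇒after (H.survives (trans (sym (at h z)) l) (s ∘ dom⁻¹) (to w) (edge zw) (trans (sym (at h w)) lw) (sw ∘ dom⁻¹)) })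
      (λ p → case H.after⇒ p of λ { (H.survives l s w zw lw sw) →
        let w≡ = sym (to-from w) in
        G.⇒after (G.survives (trans (at h z) l) (s ∘ dom) (from w) (edge⁻¹ (subst (to z H.~_) w≡ zw))
          (trans (at h (from w)) (subst (_∈ˢ M) w≡ lw)) (λ d → sw (subst (H.Dom (to v)) (to-from w) (dom d)))) })

    playable→ : ∀ {L M} → Same L M → ∀ {v} → G.Playable L v → H.Playable M (to v)
    playable→ h (z , z∈ , d) = to z , trans (sym (at h z)) z∈ , dom d

    playable← : ∀ {L M} → Same L M → ∀ {v} → H.Playable M (to v) → G.Playable L v
    playable← {L} {M} h {v} (z , z∈ , d) =
      from z , trans (at h (from z)) (subst (_∈ˢ M) (sym (to-from z)) z∈) , dom⁻¹ (subst (H.Dom (to v)) (sym (to-from z)) d)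

    after-from : ∀ {L M} → Same L M → ∀ v → Same (G.after L (from v)) (H.after M v)
    after-from {L} {M} h v = subst (λ u → Same (G.after L (from v)) (H.after M u)) (to-from v) (after-same h (from v))

    playable-from : ∀ {L M} → Same L M → ∀ {v} → H.Playable M v → G.Playable L (from v)
    playable-from {L} {M} h {v} p = playable← h (subst (H.Playable M) (sym (to-from v)) p)

  mutual
    transfer-staller : ∀ m {L M} → Same L M → H.Force m staller M → G.Force m staller L
    transfer-staller zero    h F = tt
    transfer-staller (suc m) h (v , pv , F) = from v , playable-from h pv , transfer-dominator m (after-from h v) F

    transfer-dominator : ∀ m {L M} → Same L M → H.Force m dominator M → G.Force m dominator L
    transfer-dominator zero    h F = tt
    transfer-dominator (suc m) h ((u , pu) , F) = (from u , playable-from h pu) ,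
      λ v pv → transfer-staller m (after-same h v) (F (to v) (playable→ h pv))

  initial-same : Same G.initial H.initial
  initial-same = same λ z → truth-ext
    (λ p → let w , _ , e = G.initial-closed p in H.initial-intro (edge e))
    (λ p → let w , _ , e = H.initial-closed p in
           G.initial-intro (edge⁻¹ (subst (to z H.~_) (sym (to-from w)) e)))

-- Deciding the forcing relation

allF : ∀ {n} → (Fin n → Bool) → Bool
allF {zero}  p = true
allF {suc n} p = p zero ∧ allF (p ∘ suc)

allF-elim : ∀ {n} (p : Fin n → Bool) → allF p ≡ true → ∀ i → p i ≡ true
allF-elim p q zero    = ∧-conicalˡ (p zero) _ q
allF-elim p q (suc i) = allF-elim (p ∘ suc) (∧-conicalʳ (p zero) _ q) i

module Search {k : ℕ} (H : Graph k) where
  open Play H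

  playB : Vec Bool k → Fin k → Bool
  playB S v = anyF (λ z → lookup S z ∧ domB v z)

  -- Positions are explicit tables, so that evaluating the game tree does not pile up nested
  -- applications of predicates.
  play : Vec Bool k → Fin k → Vec Bool k
  play S v = tabulate (afterB (lookup S) v)

  forceB : ℕ → Player H → Vec Bool k → Bool
  forceB zero    p         S = true
  forceB (suc m) staller   S = anyF λ v → playB S v ∧ forceB m dominator (play S v)
  forceB (suc m) dominator S = anyF (playB S) ∧ allF λ v → not (playB S v) ∨ forceB m staller (play S v)

  record Represents (S : Vec Bool k) (L : Subset k) : Set where
    constructor represents
    field
      at : ∀ z → lookup S z ≡ L z
  open Represents

  playB-sound : ∀ {S L v} → Represents S L → playB S v ≡ true → Playable L v
  playB-sound {S} {v = v} r p with z , q ← anyF-witness (λ z → lookup S z ∧ domB v z) p =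
    z , trans (sym (at r z)) (∧-conicalˡ _ _ q) , domB-sound (∧-conicalʳ (lookup S z) _ q)

  playB-complete : ∀ {S L v} → Represents S L → Playable L v → playB S v ≡ true
  playB-complete r (z , z∈ , d) = anyF-intro _ z (∧-intro (trans (at r z) z∈) (domB-complete d))

  play-represents : ∀ {S L} → Represents S L → ∀ v → Represents (play S v) (after L v)
  play-represents {S} r v = represents λ z → trans (lookup∘tabulate (afterB (lookup S) v) z) (trans (sym (after≡afterB (lookup S) v z)) (after-cong (at r) v z))

  force-sound : ∀ m p {S L} → Represents S L → forceB m p S ≡ true → Force m p L
  force-sound zero    p         r q = tt
  force-sound (suc m) staller   {S} r q with v , h ← anyF-witness (λ v → playB S v ∧ forceB m dominator (play S v)) q =
    v , playB-sound r (∧-conicalˡ _ _ h) , force-sound m dominator (play-represents r v) (∧-conicalʳ (playB S v) _ h)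
  force-sound (suc m) dominator {S} {L} r q = (proj₁ some , playB-sound r (proj₂ some)) , each
    where
    some = anyF-witness (playB S) (∧-conicalˡ _ _ q)
    each : ∀ v → Playable L v → Force m staller (after L v)
    each v pv with ∨-split (not (playB S v)) (allF-elim _ (∧-conicalʳ (anyF (playB S)) _ q) v)
    ... | inj₁ h = ⊥-elim (not-true h (playB-complete r pv))
    ... | inj₂ h = force-sound m staller (play-represents r v) h

  everything : Vec Bool k
  everything = replicate k true

  start-represents : (∀ z → Σ (Fin k) λ w → z ~ w) → Represents everything initial
  start-represents h = represents λ z → trans (lookup-replicate z true) (sym (initial-intro (proj₂ (h z))))

  opens : ℕ → Fin k → Bool
  opens m v = playB everything v ∧ forceB m dominator (play everything v)

  -- The implicit argument certifies that no vertex is isolated, so that `everything` represents the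
  -- initial live set.
  start-force : ∀ m v → {True (all? λ z → any? λ w → adj H z w Bool.≟ true)} → opens m v ≡ true →
    Force (suc m) staller initial
  start-force m v {nbrs} q = v , playB-sound r (∧-conicalˡ _ _ q) ,
    force-sound m dominator (play-represents r v) (∧-conicalʳ (playB everything v) _ q)
    where
    r = start-represents (toWitness nbrs)

-- Recognising a graph from its adjacency table

data Triangle : ℕ → Set where
  []  : Triangle 0
  _∷_ : ∀ {k} → Vec Bool k → Triangle k → Triangle (suc k)

entry : ∀ {k} → Triangle k → Fin k → Fin k → Bool
entry (r ∷ T) zero    zero    = false
entry (r ∷ T) zero    (suc j) = lookup r j
entry (r ∷ T) (suc i) zero    = lookup r i
entry (r ∷ T) (suc i) (suc j) = entry T i j

module _ {n : ℕ} (G : Graph n) where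

  RowMatches : ∀ {k} → Fin n → Vec (Fin n) k → Vec Bool k → Set
  RowMatches u []       []      = ⊤
  RowMatches u (v ∷ vs) (b ∷ r) = adj G u v ≡ b × RowMatches u vs r

  Matches : ∀ {k} → Vec (Fin n) k → Triangle k → Set
  Matches []       []      = ⊤
  Matches (u ∷ vs) (r ∷ T) = RowMatches u vs r × Matches vs T

  row-entry : ∀ {k} {u} (vs : Vec (Fin n) k) r → RowMatches u vs r → ∀ i → adj G u (lookup vs i) ≡ lookup r i
  row-entry (v ∷ vs) (b ∷ r) (e , _) zero    = e
  row-entry (v ∷ vs) (b ∷ r) (_ , h) (suc i) = row-entry vs r h i

  matches-entry : ∀ {k} (vs : Vec (Fin n) k) T → Matches vs T → ∀ i j → adj G (lookup vs i) (lookup vs j) ≡ entry T i j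
  matches-entry (u ∷ vs) (r ∷ T) (h , _)  zero    zero    = adj-irr G u
  matches-entry (u ∷ vs) (r ∷ T) (h , _)  zero    (suc j) = row-entry vs r h j
  matches-entry (u ∷ vs) (r ∷ T) (h , _)  (suc i) zero    = trans (adj-sym G _ u) (row-entry vs r h i)
  matches-entry (u ∷ vs) (r ∷ T) (_ , hs) (suc i) (suc j) = matches-entry vs T hs i j

  Fits : ∀ {k} → Triangle k → Graph k → Vec (Fin k) k → Set
  Fits T F π = ∀ i j → entry T (lookup π i) (lookup π j) ≡ adj F i j

  fits? : ∀ {k} (T : Triangle k) F π → Dec (Fits T F π)
  fits? T F π = all? λ i → all? λ j → entry T (lookup π i) (lookup π j) Bool.≟ adj F i j

  onto? : ∀ {k} (π : Vec (Fin k) k) → Dec (∀ i → ∃ λ j → lookup π j ≡ i)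
  onto? π = all? λ i → any? λ j → lookup π j ≟ i

  -- In a graph without twins, the adjacency table already forces the listed vertices to be distinct.
  twin-free? : ∀ {k} (F : Graph k) → Dec (∀ i j → i ≡ j ⊎ ∃ λ l → ¬ adj F i l ≡ adj F j l)
  twin-free? F = all? λ i → all? λ j → (i ≟ j) ⊎-dec any? λ l → ¬? (adj F i l Bool.≟ adj F j l)

  -- `π` gives the table position of each vertex of `F`, which lets mirror images and rotations of
  -- one table be matched with the same graph.
  recognise : ∀ {k} (vs : Vec (Fin n) k) (T : Triangle k) → Matches vs T → (∀ z → Σ (Fin k) λ i → lookup vs i ≡ z) →
    (F : Graph k) (π : Vec (Fin k) k) → {True (fits? T F π)} → {True (onto? π)} → {True (twin-free? F)} → Isomorphic G F
  recognise {k} vs T M cover F π {f} {o} {t} = mk↔ₛ′ to v to-v v-to , λ i j →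
    trans (sym (agrees (to i) (to j))) (cong₂ (adj G) (v-to i) (v-to j))
    where
    v : Fin k → Fin n
    v i = lookup vs (lookup π i)
    agrees : ∀ i j → adj G (v i) (v j) ≡ adj F i j
    agrees i j = trans (matches-entry vs T M (lookup π i) (lookup π j)) (toWitness f i j)
    to : Fin n → Fin k
    to z = proj₁ (toWitness o (proj₁ (cover z)))
    v-to : ∀ z → v (to z) ≡ z
    v-to z = trans (cong (lookup vs) (proj₂ (toWitness o (proj₁ (cover z))))) (proj₂ (cover z))
    v-injective : ∀ {i j} → v i ≡ v j → i ≡ j
    v-injective {i} {j} e with toWitness t i j
    ... | inj₁ p = p
    ... | inj₂ (l , ne) = ⊥-elim (ne (trans (sym (agrees i l)) (trans (cong (λ u → adj G u (v l)) e) (agrees j l))))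
    to-v : ∀ i → to (v i) ≡ i
    to-v i = v-injective (v-to (v i))

identity₄ : Vec (Fin 4) 4
identity₄ = # 0 ∷ # 1 ∷ # 2 ∷ # 3 ∷ []

identity₈ reverse₈ : Vec (Fin 8) 8
identity₈ = # 0 ∷ # 1 ∷ # 2 ∷ # 3 ∷ # 4 ∷ # 5 ∷ # 6 ∷ # 7 ∷ []
reverse₈  = # 6 ∷ # 5 ∷ # 4 ∷ # 3 ∷ # 2 ∷ # 1 ∷ # 0 ∷ # 7 ∷ []

pattern isF1 p  = inj₁ p
pattern isF2 p  = inj₂ (inj₁ p)
pattern isF3 p  = inj₂ (inj₂ (inj₁ p))
pattern isF4 p  = inj₂ (inj₂ (inj₂ (inj₁ p)))
pattern isF5 p  = inj₂ (inj₂ (inj₂ (inj₂ (inj₁ p))))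
pattern isF6 p  = inj₂ (inj₂ (inj₂ (inj₂ (inj₂ (inj₁ p)))))
pattern isF7 p  = inj₂ (inj₂ (inj₂ (inj₂ (inj₂ (inj₂ (inj₁ p))))))
pattern isF8 p  = inj₂ (inj₂ (inj₂ (inj₂ (inj₂ (inj₂ (inj₂ (inj₁ p)))))))
pattern isF9 p  = inj₂ (inj₂ (inj₂ (inj₂ (inj₂ (inj₂ (inj₂ (inj₂ (inj₁ p))))))))
pattern isF10 p = inj₂ (inj₂ (inj₂ (inj₂ (inj₂ (inj₂ (inj₂ (inj₂ (inj₂ (inj₁ p)))))))))
pattern isF11 p = inj₂ (inj₂ (inj₂ (inj₂ (inj₂ (inj₂ (inj₂ (inj₂ (inj₂ (inj₂ p)))))))))

pattern T = true
pattern F = false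

-- Identifying the graphs with at least four live vertices after the opening

module Classify {n : ℕ} (G : Graph n) {m : ℕ} {L : Subset n} (t : Strategy.Tight G (2 + m) L)
  (x y : Fin n) (x~y : adj G x y ≡ true) (y∉ : y ∉ˢ L) (full : ∀ {z} → z ≢ x → z ≢ y → z ∈ˢ L)
  (leaf : ∀ {z} → adj G x z ≡ true → z ≡ y) (walk : ∀ z → Walk G z y) where

  open Play G
  open Strategy G

  open Chains G
  open Walking t
  open Tight₂ t
  open Leaf G t x y y∉ full leaf walk

  x-far : ∀ {z} → z ∈ˢ L → adj G z x ≡ false
  x-far z∈ = ¬-not λ e → y∉ (subst (_∈ˢ L) (leaf (~-sym e)) z∈)

  module _ (H : Hexagon) where
    open Hexagon H
    open Chain C

    private
      far : ∀ i {z} → z ∈ˢ L → z ≢ c i → z ≢ c (2 + i) → adj G z (c (1 + i)) ≡ false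
      far i z∈ ne ne′ = ¬-not λ e → [ ne , ne′ ]′ (nbr (md i) z∈ (~-sym e))

      y-bit : ∀ i → adj G (c i) y ≡ adj G y (c i)
      y-bit i = adj-sym G (c i) y

      closing : Mid L (c 5) (c 4) (c 0)
      closing = subst (Mid L (c 5) (c 4)) per (md 4)

      -- Playing y would isolate q.
      cherry : ∀ {q p r z} → Mid L q p r → y ~ p → y ~ r → z ∈ˢ L → y ~ z → z ∉ q ∷ p ∷ r ∷ [] → ⊥
      cherry M yp yr z∈ yz o = no-four _ refl (o ∷ mid-uniq M)
        (dom-killed z∈ (inj₂ yz)
          ∷ isolated-killed (Mid.v∈ M) (λ w∈ e → [ (λ { refl → inj₂ yp }) , (λ { refl → inj₂ yr }) ]′ (nbr M w∈ e))
          ∷ dom-killed (Mid.a∈ M) (inj₂ yp) ∷ dom-killed (Mid.b∈ M) (inj₂ yr) ∷ [])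
        (_ , z∈ , inj₂ yz)

      vs : Vec (Fin n) 8
      vs = c 0 ∷ c 1 ∷ c 2 ∷ c 3 ∷ c 4 ∷ c 5 ∷ x ∷ y ∷ []

      table : Bool → Bool → Bool → Bool → Bool → Triangle 8
      table b₁ b₂ b₃ b₄ b₅ =
        (T ∷ F ∷ F ∷ F ∷ T ∷ F ∷ T ∷ []) ∷ (T ∷ F ∷ F ∷ F ∷ F ∷ b₁ ∷ []) ∷ (T ∷ F ∷ F ∷ F ∷ b₂ ∷ []) ∷
        (T ∷ F ∷ F ∷ b₃ ∷ []) ∷ (T ∷ F ∷ b₄ ∷ []) ∷ (F ∷ b₅ ∷ []) ∷ (T ∷ []) ∷ [] ∷ []

      n₀₅ : c 0 ≢ c 5
      n₀₅ q = n₁ 5 (trans (sym q) (sym per))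

      matches : ∀ {b₁ b₂ b₃ b₄ b₅} → adj G y (c 1) ≡ b₁ → adj G y (c 2) ≡ b₂ → adj G y (c 3) ≡ b₃ →
        adj G y (c 4) ≡ b₄ → adj G y (c 5) ≡ b₅ → Matches G vs (table b₁ b₂ b₃ b₄ b₅)
      matches e₁ e₂ e₃ e₄ e₅ =
        (e 0 , far 1 (c∈ 0) (n₁ 0) (n₃ 0) , far 2 (c∈ 0) (n₂ 0) (n₄ 0) , far 3 (c∈ 0) (n₃ 0) n₀₅ ,
          ~-sym (Mid.v~b closing) , x-far (c∈ 0) , ~-sym y~c₀ , tt) ,
        (e 1 , far 2 (c∈ 1) (n₁ 1) (n₃ 1) , far 3 (c∈ 1) (n₂ 1) (n₄ 1) ,
          far 4 (c∈ 1) (n₃ 1) (λ q → n₁ 0 (trans (sym per) (sym q))) , x-far (c∈ 1) , trans (y-bit 1) e₁ , tt) ,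
        (e 2 , far 3 (c∈ 2) (n₁ 2) (n₃ 2) , far 4 (c∈ 2) (n₂ 2) (n₄ 2) , x-far (c∈ 2) , trans (y-bit 2) e₂ , tt) ,
        (e 3 , far 4 (c∈ 3) (n₁ 3) (n₃ 3) , x-far (c∈ 3) , trans (y-bit 3) e₃ , tt) ,
        (e 4 , x-far (c∈ 4) , trans (y-bit 4) e₄ , tt) ,
        (x-far (c∈ 5) , trans (y-bit 5) e₅ , tt) ,
        (x~y , tt) , tt , tt

      all-vs : ∀ z → Σ (Fin 8) λ i → lookup vs i ≡ z
      all-vs z with z ≟ x | z ≟ y
      ... | yes p | _ = # 6 , sym p
      ... | no _ | yes p = # 7 , sym p
      ... | no nx | no ny with cover (full nx ny)
      ...   | here p = # 0 , sym p
      ...   | there (here p) = # 1 , sym p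
      ...   | there (there (here p)) = # 2 , sym p
      ...   | there (there (there (here p))) = # 3 , sym p
      ...   | there (there (there (there (here p)))) = # 4 , sym p
      ...   | there (there (there (there (there (here p))))) = # 5 , sym p

      -- The bits record which of `c 1` to `c 5` are adjacent to `y`. By `cherry`, if `y` is
      -- adjacent to two cycle vertices at distance two, all its cycle neighbors lie on the path of
      -- three vertices between them. Up to symmetry this leaves one neighbor, a pair at distance
      -- one, two or three, and three consecutive vertices.
      classify : ∀ b₁ b₂ b₃ b₄ b₅ → adj G y (c 1) ≡ b₁ → adj G y (c 2) ≡ b₂ → adj G y (c 3) ≡ b₃ →
        adj G y (c 4) ≡ b₄ → adj G y (c 5) ≡ b₅ → Matches G vs (table b₁ b₂ b₃ b₄ b₅) → IsOneOfF G
      classify T _ T _ _ e₁ e₂ e₃ e₄ e₅ M = ⊥-elim (cherry (md 1) e₁ e₃ (c∈ 0) y~c₀ (n₂ 0 ∷ n₁ 0 ∷ n₃ 0 ∷ []))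
      classify T _ _ T _ e₁ e₂ e₃ e₄ e₅ M = ⊥-elim (cherry closing e₄ y~c₀ (c∈ 1) e₁ (n₄ 1 ∷ n₃ 1 ∷ ≢-sym (n₁ 0) ∷ []))
      classify _ T T _ _ e₁ e₂ e₃ e₄ e₅ M = ⊥-elim (cherry (md 0) y~c₀ e₂ (c∈ 3) e₃ (≢-sym (n₂ 1) ∷ ≢-sym (n₃ 0) ∷ ≢-sym (n₁ 2) ∷ []))
      classify _ T _ T _ e₁ e₂ e₃ e₄ e₅ M = ⊥-elim (cherry (md 0) y~c₀ e₂ (c∈ 4) e₄ (≢-sym (n₃ 1) ∷ ≢-sym (n₄ 0) ∷ ≢-sym (n₂ 2) ∷ []))
      classify _ T _ _ T e₁ e₂ e₃ e₄ e₅ M = ⊥-elim (cherry (md 0) y~c₀ e₂ (c∈ 5) e₅ (≢-sym (n₄ 1) ∷ ≢-sym n₀₅ ∷ ≢-sym (n₃ 2) ∷ []))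
      classify _ _ T T _ e₁ e₂ e₃ e₄ e₅ M = ⊥-elim (cherry closing e₄ y~c₀ (c∈ 3) e₃ (n₂ 3 ∷ n₁ 3 ∷ ≢-sym (n₃ 0) ∷ []))
      classify _ _ T _ T e₁ e₂ e₃ e₄ e₅ M = ⊥-elim (cherry (md 3) e₃ e₅ (c∈ 0) y~c₀ (n₄ 0 ∷ n₃ 0 ∷ n₀₅ ∷ []))
      classify F F F F F _ _ _ _ _ M = isF7 (recognise G vs (table F F F F F) M all-vs F7 identity₈)
      classify T F F F F _ _ _ _ _ M = isF8 (recognise G vs (table T F F F F) M all-vs F8 identity₈)
      classify F F F F T _ _ _ _ _ M = isF8 (recognise G vs (table F F F F T) M all-vs F8 mirror)
        where mirror = # 0 ∷ # 5 ∷ # 4 ∷ # 3 ∷ # 2 ∷ # 1 ∷ # 6 ∷ # 7 ∷ []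
      classify F T F F F _ _ _ _ _ M = isF9 (recognise G vs (table F T F F F) M all-vs F9 identity₈)
      classify F F F T F _ _ _ _ _ M = isF9 (recognise G vs (table F F F T F) M all-vs F9 mirror)
        where mirror = # 0 ∷ # 5 ∷ # 4 ∷ # 3 ∷ # 2 ∷ # 1 ∷ # 6 ∷ # 7 ∷ []
      classify F F T F F _ _ _ _ _ M = isF10 (recognise G vs (table F F T F F) M all-vs F10 identity₈)
      classify T T F F F _ _ _ _ _ M = isF11 (recognise G vs (table T T F F F) M all-vs F11 mirror)
        where mirror = # 1 ∷ # 0 ∷ # 5 ∷ # 4 ∷ # 3 ∷ # 2 ∷ # 6 ∷ # 7 ∷ []
      classify T F F F T _ _ _ _ _ M = isF11 (recognise G vs (table T F F F T) M all-vs F11 identity₈)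
      classify F F F T T _ _ _ _ _ M = isF11 (recognise G vs (table F F F T T) M all-vs F11 rotation)
        where rotation = # 5 ∷ # 0 ∷ # 1 ∷ # 2 ∷ # 3 ∷ # 4 ∷ # 6 ∷ # 7 ∷ []

    hexagon-F : IsOneOfF G
    hexagon-F = classify _ _ _ _ _ refl refl refl refl refl (matches refl refl refl refl refl)

  module _ (W : Twins) where
    open Twins W

    private
      -- The order is that of the path in `F4`, with `x` as the extra vertex. What remains open is
      -- whether each triple is a triangle, one bit for each.
      vs : Vec (Fin n) 8
      vs = b₂ ∷ b₁ ∷ b₀ ∷ y ∷ a₀ ∷ a₁ ∷ a₂ ∷ x ∷ []

      table : Bool → Bool → Triangle 8
      table p q =
        (T ∷ p ∷ F ∷ F ∷ F ∷ F ∷ F ∷ []) ∷ (T ∷ F ∷ F ∷ F ∷ F ∷ F ∷ []) ∷ (T ∷ F ∷ F ∷ F ∷ F ∷ []) ∷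
        (T ∷ F ∷ F ∷ T ∷ []) ∷ (T ∷ q ∷ F ∷ []) ∷ (T ∷ F ∷ []) ∷ (F ∷ []) ∷ [] ∷ []

      matches : ∀ {p q} → adj G b₂ b₀ ≡ p → adj G a₀ a₂ ≡ q → Matches G vs (table p q)
      matches p q =
        (~-sym (Mid.v~b B) , p , off y≁b₂ , far j₂ i₀ , far j₂ i₁ , far j₂ i₂ , x-far (Mid.b∈ B) , tt) ,
        (Mid.v~a B , off y≁b₁ , far j₁ i₀ , far j₁ i₁ , far j₁ i₂ , x-far (Mid.v∈ B) , tt) ,
        (~-sym y~b₀ , far j₀ i₀ , far j₀ i₁ , far j₀ i₂ , x-far (Mid.a∈ B) , tt) ,
        (y~a₀ , ¬-not y≁a₁ , ¬-not y≁a₂ , ~-sym x~y , tt) ,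
        (~-sym (Mid.v~a A) , q , x-far (Mid.a∈ A) , tt) ,
        (Mid.v~b A , x-far (Mid.v∈ A) , tt) ,
        (x-far (Mid.b∈ A) , tt) , tt , tt
        where
        off : ∀ {z} → ¬ y ~ z → adj G z y ≡ false
        off h = ¬-not (h ∘ ~-sym)
        far : ∀ {z z′} → z ∈ b₁ ∷ b₀ ∷ b₂ ∷ [] → z′ ∈ a₁ ∷ a₀ ∷ a₂ ∷ [] → adj G z z′ ≡ false
        far j i = ¬-not (apart i j ∘ ~-sym)
        i₀ : a₀ ∈ a₁ ∷ a₀ ∷ a₂ ∷ []
        i₀ = there (here refl)
        i₁ : a₁ ∈ a₁ ∷ a₀ ∷ a₂ ∷ []
        i₁ = here refl
        i₂ : a₂ ∈ a₁ ∷ a₀ ∷ a₂ ∷ []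
        i₂ = there (there (here refl))
        j₀ : b₀ ∈ b₁ ∷ b₀ ∷ b₂ ∷ []
        j₀ = there (here refl)
        j₁ : b₁ ∈ b₁ ∷ b₀ ∷ b₂ ∷ []
        j₁ = here refl
        j₂ : b₂ ∈ b₁ ∷ b₀ ∷ b₂ ∷ []
        j₂ = there (there (here refl))

      all-vs : ∀ z → Σ (Fin 8) λ i → lookup vs i ≡ z
      all-vs z with z ≟ x | z ≟ y
      ... | yes p | _ = # 7 , sym p
      ... | no _ | yes p = # 3 , sym p
      ... | no nx | no ny with cover (full nx ny)
      ...   | inj₁ (here p) = # 5 , sym p
      ...   | inj₁ (there (here p)) = # 4 , sym p
      ...   | inj₁ (there (there (here p))) = # 6 , sym p
      ...   | inj₂ (here p) = # 1 , sym p
      ...   | inj₂ (there (here p)) = # 2 , sym p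
      ...   | inj₂ (there (there (here p))) = # 0 , sym p

      classify : ∀ p q → Matches G vs (table p q) → IsOneOfF G
      classify F F M = isF4 (recognise G vs (table F F) M all-vs F4 identity₈)
      classify T F M = isF5 (recognise G vs (table T F) M all-vs F5 identity₈)
      classify F T M = isF5 (recognise G vs (table F T) M all-vs F5 reverse₈)
      classify T T M = isF6 (recognise G vs (table T T) M all-vs F6 identity₈)

    twins-F : IsOneOfF G
    twins-F = classify _ _ (matches refl refl)

  large-F : IsOneOfF G
  large-F = [ hexagon-F , twins-F ]′ structure

-- The equality case after the opening move

module Equality {n : ℕ} (G : Graph n) {L : Subset n}
  (x y : Fin n) (x~y : adj G x y ≡ true) (y∉ : y ∉ˢ L) (full : ∀ {z} → z ≢ x → z ≢ y → z ∈ˢ L)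
  (leaf : ∀ {z} → adj G x z ≡ true → z ≡ y) (walk : ∀ z → Walk G z y) where

  open Play G
  open Strategy G

  open Escape G x y y∉ full leaf walk

  K₂-F : (∀ z → z ∉ˢ L) → IsOneOfF G
  K₂-F none = isF1 (recognise G (x ∷ y ∷ []) ((T ∷ []) ∷ [] ∷ []) ((x~y , tt) , tt , tt) all-vs F1 (# 0 ∷ # 1 ∷ []))
    where
    all-vs : ∀ z → Σ (Fin 2) λ i → lookup (x ∷ y ∷ []) i ≡ z
    all-vs z with z ≟ x | z ≟ y
    ... | yes p | _ = # 0 , sym p
    ... | no _ | yes p = # 1 , sym p
    ... | no nx | no ny = ⊥-elim (none z (full nx ny))

  -- The live vertices form a single edge with `u` adjacent to `y`; only the adjacency of `y` and
  -- `w` is open, which distinguishes the path from the paw.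
  small-F : Tight 1 L → IsOneOfF G
  small-F t with _ , z , z∈ , _ ← proj₁ (Tight.force t)
            with u , _ , u∈ , y~u ← escape (λ _ → ⊤) (λ _ _ _ _ → tt) tt z∈
            with w , w∈ , u~w ← Tight.closed t u∈ = classify (adj G y w) (matches refl)
    where
    vs : Vec (Fin n) 4
    vs = x ∷ y ∷ u ∷ w ∷ []

    table : Bool → Triangle 4
    table b = (T ∷ F ∷ F ∷ []) ∷ (T ∷ b ∷ []) ∷ (T ∷ []) ∷ [] ∷ []

    x-far : ∀ {z} → z ∈ˢ L → adj G x z ≡ false
    x-far z∈ = ¬-not λ e → y∉ (subst (_∈ˢ L) (leaf e) z∈)

    matches : ∀ {b} → adj G y w ≡ b → Matches G vs (table b)
    matches e = (x~y , x-far u∈ , x-far w∈ , tt) , (y~u , e , tt) , (u~w , tt) , tt , tt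

    all-vs : ∀ z → Σ (Fin 4) λ i → lookup vs i ≡ z
    all-vs z with z ≟ x | z ≟ y | z ≟ u | z ≟ w
    ... | yes p | _ | _ | _ = # 0 , sym p
    ... | _ | yes p | _ | _ = # 1 , sym p
    ... | _ | _ | yes p | _ = # 2 , sym p
    ... | _ | _ | _ | yes p = # 3 , sym p
    ... | no nx | no ny | no nu | no nw =
      case tight-lower t _ (uniq3 nu nw (~⇒≢ u~w)) (full nx ny ∷ u∈ ∷ w∈ ∷ []) of λ { (s≤s (s≤s ())) }

    classify : ∀ b → Matches G vs (table b) → IsOneOfF G
    classify F M = isF2 (recognise G vs (table F) M all-vs F2 identity₄)
    classify T M = isF3 (recognise G vs (table T) M all-vs F3 (# 1 ∷ # 2 ∷ # 3 ∷ # 0 ∷ []))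

  tight-F : ∀ {m} → Tight m L → IsOneOfF G
  tight-F {zero} t = K₂-F λ z z∈ → case tight-lower t (z ∷ []) ([] ∷ []) (z∈ ∷ []) of λ ()
  tight-F {suc zero} t = small-F t
  tight-F {suc (suc m)} t = Classify.large-F G t x y x~y y∉ full leaf walk

-- The bound and both directions of the equality statement

module Main {n : ℕ} (G : Graph n) where
  open Play G
  open Strategy G

  value : ℕ
  value = isolationGameS G

  value-bound : 2 * value ≤ n
  value-bound = ≤-trans
    (initial-bound value initial-intro initial-closed (value⇒Force n staller (λ _ → false) initial value (λ _ → refl) ≤-refl))
    (countF≤n initial)

  has-nbr : Connected G → ∀ {z w} → z ≢ w → Σ (Fin n) λ v → z ~ v
  has-nbr con {z} {w} ne with con z w
  ... | here = ⊥-elim (ne refl)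
  ... | step e _ = _ , e

  -- In case of equality the opening move removes exactly two vertices, `x` and one neighbor `y`.
  -- Hence all others stay live, and as `x` then dominates none of them, it is a leaf.
  forced-F : Connected G → ∀ m → 2 * suc m ≡ n → Force (suc m) staller initial → IsOneOfF G
  forced-F con m eq (x , (z , z∈ , d) , force) = Equality.tight-F G x y x~y y∉ full leaf (λ z → con z y) tightL
    where
    L = after initial x
    first-nbr : Dom x z → Σ (Fin n) λ v → x ~ v
    first-nbr (inj₁ refl) with w , _ , e ← initial-closed z∈ = w , e
    first-nbr (inj₂ e) = z , e
    y = proj₁ (first-nbr d)
    x~y = proj₂ (first-nbr d)
    kx : Killed initial x x
    kx = dom-killed (initial-intro x~y) (inj₁ refl)
    ky : Killed initial x y
    ky = dom-killed (initial-intro (~-sym x~y)) (inj₂ x~y)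
    y∉ = proj₂ ky
    budget : countF initial ≤ 2 + 2 * m
    budget = ≤-trans (countF≤n initial) (≤-reflexive (trans (sym eq) (*-suc 2 m)))
    tightL : Tight m L
    tightL = tight after-closed force (+-cancelˡ-≤ 2 _ _
      (≤-trans (kill-gap (x ∷ y ∷ []) ((~⇒≢ x~y ∷ []) ∷ [] ∷ []) (kx ∷ ky ∷ [])) budget))
    full : ∀ {z} → z ≢ x → z ≢ y → z ∈ˢ L
    full {z} nx ny with L z Bool.≟ true
    ... | yes p = p
    ... | no ¬p = ⊥-elim (1+n≰n (≤-trans (+-monoʳ-≤ 3 (force-bound m after-closed force))
      (≤-trans (kill-gap (z ∷ x ∷ y ∷ []) (uniq3 nx ny (~⇒≢ x~y))
        ((initial-intro (proj₂ (has-nbr con nx)) , ¬p) ∷ kx ∷ ky ∷ [])) budget)))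
    leaf : ∀ {z} → x ~ z → z ≡ y
    leaf {z} e with z ≟ y
    ... | yes p = p
    ... | no ny = ⊥-elim (Survives.safe (after⇒ (full (≢-sym (~⇒≢ e)) ny)) (inj₂ e))

  equality-F : 1 ≤ n → Connected G → 2 * value ≡ n → IsOneOfF G
  equality-F 1≤n con eq = go value eq (value⇒Force n staller (λ _ → false) initial value (λ _ → refl) ≤-refl)
    where
    go : ∀ m → 2 * m ≡ n → Force m staller initial → IsOneOfF G
    go zero e f = case ≤-trans 1≤n (≤-reflexive (sym e)) of λ ()
    go (suc m) e f = forced-F con m e f

  -- The upper bound holds for every graph, so a strategy for Staller on the concrete graph, carried
  -- over by the isomorphism, settles the value.
  forced-equality : ∀ m (H : Graph (2 * m)) → Play.Force H m staller (Play.initial H) → Isomorphic G H → 2 * value ≡ n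
  forced-equality m H f φ = ≤-antisym value-bound (≤-trans (≤-reflexive n≡) (*-monoʳ-≤ 2 m≤value))
    where
    n≡ : n ≡ 2 * m
    n≡ = ↔⇒≡ (proj₁ φ)
    m≤value : m ≤ value
    m≤value = Force⇒value n staller (λ _ → false) initial m (λ _ → refl)
      (≤-trans (m≤m+n m _) (≤-reflexive (sym n≡))) (Transfer.transfer-staller φ m (Transfer.initial-same φ) f)

  -- Staller's opening vertex is a leaf in each graph, as it has to be in case of equality; the rest
  -- of the game tree is decided by evaluation.
  F-equality : IsOneOfF G → 2 * value ≡ n
  F-equality (isF1 φ)  = forced-equality 1 F1 (Search.start-force F1 0 (# 0) refl) φ
  F-equality (isF2 φ)  = forced-equality 2 F2 (Search.start-force F2 1 (# 0) refl) φ
  F-equality (isF3 φ)  = forced-equality 2 F3 (Search.start-force F3 1 (# 3) refl) φ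
  F-equality (isF4 φ)  = forced-equality 4 F4 (Search.start-force F4 3 (# 7) refl) φ
  F-equality (isF5 φ)  = forced-equality 4 F5 (Search.start-force F5 3 (# 7) refl) φ
  F-equality (isF6 φ)  = forced-equality 4 F6 (Search.start-force F6 3 (# 7) refl) φ
  F-equality (isF7 φ)  = forced-equality 4 F7 (Search.start-force F7 3 (# 6) refl) φ
  F-equality (isF8 φ)  = forced-equality 4 F8 (Search.start-force F8 3 (# 6) refl) φ
  F-equality (isF9 φ)  = forced-equality 4 F9 (Search.start-force F9 3 (# 6) refl) φ
  F-equality (isF10 φ) = forced-equality 4 F10 (Search.start-force F10 3 (# 6) refl) φ
  F-equality (isF11 φ) = forced-equality 4 F11 (Search.start-force F11 3 (# 6) refl) φ

theorem3p2 : (n : ℕ) (G : Graph n) → 1 ≤ n → Connected G →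
    (2 * isolationGameS G ≤ n) × ((2 * isolationGameS G ≡ n) ⇔ IsOneOfF G)
theorem3p2 n G 1≤n con = Main.value-bound G , mk⇔ (Main.equality-F G 1≤n con) (Main.F-equality G)
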